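{- Let $G$ be a finite connected graph (loops and multiple edges allowed) and let $\alpha(G)$ denote the number of Eulerian equivalence classes of $\mathcal{BO}(G)$. Then $$\alpha(G)=T_G(0,1),$$ where $T_G(x,y)$ is the Tutte polynomial of $G$. Equivalently, $\alpha(G)$ equals the number of spanning trees of $G$ having no internally active edge with respect to any fixed total order on $E(G)$.
   Context: An orientation of $G=(V,E)$ assigns a direction to each edge. For a partition $V=S\sqcup T$ with $S,T\neq\emptyset$, $[S,T]$ denotes the set of edges joining $S$ and $T$ (a cut); a bond is a minimal nonempty cut. For an orientation $\varepsilon$, $(S,T)_\varepsilon$ is the set of edges of $[S,T]$ directed from $S$ to $T$. A bond $[S,T]$ is directed (relative to $\varepsilon$) if $(S,T)_\varepsilon=\emptyset$ or $(T,S)_\varepsilon=\emptyset$; a cut is directed if it is a disjoint union of directed bonds. $\mathcal{BO}(G)$ is the set of orientations of $G$ having no (nonempty) directed cut; for connected $G$ these are exactly the totally cyclic orientations (every edge lies on a directed cycle). Two orientations $\varepsilon_1,\varepsilon_2$ are Eulerian equivalent if the spanning subgraph formed by the edges $\{e:\varepsilon_1(e)\neq\varepsilon_2(e)\}$, oriented by $\varepsilon_1$, has in-degree equal to out-degree at every vertex. The Tutte polynomial is defined by $T_{E_n}=1$ for the edgeless graph $E_n$, $T_G=xT_{G/e}$ if $e$ is a bridge, $T_G=yT_{G-e}$ if $e$ is a loop, and $T_G=T_{G-e}+T_{G/e}$ otherwise. Given a total order on $E$ and a spanning tree $F$, an edge $f\in F$ is internally active if it is the smallest edge of the cut $\{e\in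 E: (F-f)+e \text{ is a spanning tree}\}$; one has $T_G(x,y)=\sum_{i,j}t_{ij}x^iy^j$ where $t_{ij}$ is the number of spanning trees with exactly $i$ internally active and $j$ externally active edges. -}

module Defs where

open import Data.Bool.Base using (Bool; true; false; not; _∧_; _xor_; if_then_else_)
open import Data.Fin.Base using (Fin; zero; suc; punchIn; punchOut)
open import Data.Fin.Properties using (_≟_)
open import Data.Fin.Subset
open import Data.List.Base as List using (List; []; _∷_; foldr)
open import Data.List.Relation.Unary.All using (All)
open import Data.List.Relation.Unary.AllPairs using (AllPairs)
open import Data.List.Relation.Unary.Unique.Propositional using (Unique)
open import Data.Nat.Base using (ℕ; zero; suc; _+_; _*_)
open import Data.Nat.Properties using (+-comm; +-cancelˡ-≡; +-cancelʳ-≡; +-commutativeSemigroup)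
open import Algebra.Properties.CommutativeSemigroup +-commutativeSemigroup using (interchange)
open import Data.Product.Base using (∃-syntax; _×_; proj₁)
open import Data.Sum.Base using (_⊎_)
open import Data.Vec.Base using (Vec; []; _∷_; lookup; tabulate; zipWith)
open import Data.Vec.Properties using (lookup∘tabulate; lookup-zipWith)
open import Function.Base using (_∘_)
open import Function.Bundles using (Inverse)
open import Level using (0ℓ)
open import Relation.Binary.Bundles using (Setoid)
open import Relation.Binary.Core using (Rel)
open import Relation.Binary.Construct.Closure.ReflexiveTransitive using (Star; ε; _◅_)
import Relation.Binary.Construct.On as On
open import Relation.Binary.PropositionalEquality
open import Relation.Nullary using (¬_; yes; no; does)

-- n vertices and m edges; loops and parallel edges are allowed.  The
-- order of the two ends of an edge is only a reference direction.
record Graph (n m : ℕ) : Set where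
  field
    src tgt : Fin m → Fin n

open Graph public

module _ {n m : ℕ} (G : Graph n m) where

  IsLoop : Fin m → Set
  IsLoop e = src G e ≡ tgt G e

  record Step (F : Subset m) (u v : Fin n) : Set where
    constructor step
    field
      edge  : Fin m
      inF   : edge ∈ F
      joins : (src G edge ≡ u × tgt G edge ≡ v) ⊎ (src G edge ≡ v × tgt G edge ≡ u)

  -- Walks in the spanning subgraph with edge set F.
  Walk : Subset m → Fin n → Fin n → Set
  Walk F = Star (Step F)

  walkEdges : ∀ {F u v} → Walk F u v → List (Fin m)
  walkEdges ε       = []
  walkEdges (s ◅ w) = Step.edge s ∷ walkEdges w

  -- All vertices of the walk except the last one.
  walkVertices : ∀ {F u v} → Walk F u v → List (Fin n)
  walkVertices         ε       = []
  walkVertices {u = u} (_ ◅ w) = u ∷ walkVertices w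

  ConnectedBy : Subset m → Set
  ConnectedBy F = ∀ u v → Walk F u v

  Connected : Set
  Connected = ConnectedBy ⊤

  record Cycle (F : Subset m) : Set where
    field
      base            : Fin n
      walk            : Walk F base base
      nonempty        : walkEdges walk ≢ []
      unique-edges    : Unique (walkEdges walk)
      unique-vertices : Unique (walkVertices walk)

  IsSpanningTree : Subset m → Set
  IsSpanningTree F = ConnectedBy F × ¬ Cycle F

  IsBridge : Fin m → Set
  IsBridge e = ¬ Walk (⊤ - e) (src G e) (tgt G e)

  -- S encodes the partition V = S ⊔ ∁ S.
  Proper : Subset n → Set
  Proper S = Nonempty S × Nonempty (∁ S)

  cut : Subset n → Subset m
  cut S = tabulate λ e → lookup S (src G e) xor lookup S (tgt G e)

  IsCut : Subset m → Set
  IsCut C = ∃[ S ] Proper S × C ≡ cut S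

  IsBond : Subset m → Set
  IsBond B = IsCut B × Nonempty B
           × (∀ C → IsCut C → Nonempty C → C ⊆ B → C ≡ B)

-- true: the edge is directed from src to tgt; false: from tgt to src.
-- In particular a loop has two orientations.
Orientation : ℕ → Set
Orientation m = Vec Bool m

module _ {n m : ℕ} (G : Graph n m) (o : Orientation m) where

  tail head : Fin m → Fin n
  tail e = if lookup o e then src G e else tgt G e
  head e = if lookup o e then tgt G e else src G e

  -- (S , ∁ S)_o
  edgesOutOf : Subset n → Subset m
  edgesOutOf S = tabulate λ e → lookup S (tail e) ∧ not (lookup S (head e))

  IsDirectedBond : Subset m → Set
  IsDirectedBond B = IsBond G B ×
    (∃[ S ] Proper G S × B ≡ cut G S
          × (Empty (edgesOutOf S) ⊎ Empty (edgesOutOf (∁ S))))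

  IsDirectedCut : Subset m → Set
  IsDirectedCut C = IsCut G C ×
    (∃[ Bs ] All IsDirectedBond Bs
           × AllPairs (λ B B′ → Empty (B ∩ B′)) Bs
           × C ≡ ⋃ Bs)

  BO : Set
  BO = ¬ (∃[ C ] Nonempty C × IsDirectedCut C)

  headsAt tailsAt : Fin n → Subset m
  headsAt v = tabulate λ e → does (head e ≟ v)
  tailsAt v = tabulate λ e → does (tail e ≟ v)

  -- Degrees in the spanning subgraph with edge set D, oriented by o; a
  -- loop at v contributes one to each.
  indegree outdegree : Subset m → Fin n → ℕ
  indegree  D v = ∣ D ∩ headsAt v ∣
  outdegree D v = ∣ D ∩ tailsAt v ∣

difference : ∀ {m} → Orientation m → Orientation m → Subset m
difference = zipWith _xor_

EulerianEquivalent : ∀ {n m} → Graph n m → Rel (Orientation m) 0ℓ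
EulerianEquivalent G o₁ o₂ =
  ∀ v → indegree G o₁ (difference o₁ o₂) v ≡ outdegree G o₁ (difference o₁ o₂) v

-- Transitivity is not visible from the definition.  It follows from
-- the fact that equivalent orientations are those with the same number
-- of edges pointing to each vertex.

private
  bit : Bool → ℕ
  bit b = if b then 1 else 0

  ∣∷∣ : ∀ {m} b (p : Subset m) → ∣ b ∷ p ∣ ≡ bit b + ∣ p ∣
  ∣∷∣ true  p = refl
  ∣∷∣ false p = refl

  ∣∣-+ : ∀ {m} (p q r s : Subset m) →
         (∀ e → bit (lookup p e) + bit (lookup q e) ≡ bit (lookup r e) + bit (lookup s e)) →
         ∣ p ∣ + ∣ q ∣ ≡ ∣ r ∣ + ∣ s ∣
  ∣∣-+ []      []      []      []      h = refl
  ∣∣-+ (a ∷ p) (b ∷ q) (c ∷ r) (d ∷ s) h = begin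
    ∣ a ∷ p ∣ + ∣ b ∷ q ∣             ≡⟨ cong₂ _+_ (∣∷∣ a p) (∣∷∣ b q) ⟩
    (bit a + ∣ p ∣) + (bit b + ∣ q ∣) ≡⟨ interchange (bit a) _ (bit b) _ ⟩
    (bit a + bit b) + (∣ p ∣ + ∣ q ∣) ≡⟨ cong₂ _+_ (h zero) (∣∣-+ p q r s (h ∘ suc)) ⟩
    (bit c + bit d) + (∣ r ∣ + ∣ s ∣) ≡⟨ interchange (bit c) _ (∣ r ∣) _ ⟩
    (bit c + ∣ r ∣) + (bit d + ∣ s ∣) ≡⟨ cong₂ _+_ (∣∷∣ c r) (∣∷∣ d s) ⟨
    ∣ c ∷ r ∣ + ∣ d ∷ s ∣             ∎
    where open ≡-Reasoning

module _ {n m : ℕ} (G : Graph n m) where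

  private
    exchange : ∀ o₁ o₂ v →
      indegree G o₁ (difference o₁ o₂) v + ∣ headsAt G o₂ v ∣ ≡
      outdegree G o₁ (difference o₁ o₂) v + ∣ headsAt G o₁ v ∣
    exchange o₁ o₂ v = ∣∣-+
      (D ∩ headsAt G o₁ v) (headsAt G o₂ v) (D ∩ tailsAt G o₁ v) (headsAt G o₁ v) pointwise
      where
      D = difference o₁ o₂
      pointwise : ∀ e →
        bit (lookup (D ∩ headsAt G o₁ v) e) + bit (lookup (headsAt G o₂ v) e) ≡
        bit (lookup (D ∩ tailsAt G o₁ v) e) + bit (lookup (headsAt G o₁ v) e)
      pointwise e
        rewrite lookup-zipWith _∧_ e D (headsAt G o₁ v)
              | lookup-zipWith _∧_ e D (tailsAt G o₁ v)
              | lookup-zipWith _xor_ e o₁ o₂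
              | lookup∘tabulate (λ e → does (head G o₁ e ≟ v)) e
              | lookup∘tabulate (λ e → does (head G o₂ e ≟ v)) e
              | lookup∘tabulate (λ e → does (tail G o₁ e ≟ v)) e
        with lookup o₁ e | lookup o₂ e
      ... | true  | true  = refl
      ... | true  | false = +-comm (bit (does (tgt G e ≟ v))) _
      ... | false | true  = +-comm (bit (does (src G e ≟ v))) _
      ... | false | false = refl

  equivalent⇒sameHeads : ∀ o₁ o₂ → EulerianEquivalent G o₁ o₂ →
                         ∀ v → ∣ headsAt G o₁ v ∣ ≡ ∣ headsAt G o₂ v ∣
  equivalent⇒sameHeads o₁ o₂ eq v = sym (+-cancelˡ-≡ _ _ _
    (trans (exchange o₁ o₂ v) (cong (_+ ∣ headsAt G o₁ v ∣) (sym (eq v)))))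

  sameHeads⇒equivalent : ∀ o₁ o₂ →
                         (∀ v → ∣ headsAt G o₁ v ∣ ≡ ∣ headsAt G o₂ v ∣) →
                         EulerianEquivalent G o₁ o₂
  sameHeads⇒equivalent o₁ o₂ eq v = +-cancelʳ-≡ _ _ _
    (trans (exchange o₁ o₂ v) (cong (outdegree G o₁ (difference o₁ o₂) v +_) (eq v)))

  orientationSetoid : Setoid 0ℓ 0ℓ
  orientationSetoid = record
    { Carrier       = Orientation m
    ; _≈_           = EulerianEquivalent G
    ; isEquivalence = record
      { refl  = λ {o} → sameHeads⇒equivalent o o λ v → refl
      ; sym   = λ {o₁} {o₂} p → sameHeads⇒equivalent o₂ o₁ λ v →
                  sym (equivalent⇒sameHeads o₁ o₂ p v)
      ; trans = λ {o₁} {o₂} {o₃} p q → sameHeads⇒equivalent o₁ o₃ λ v →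
                  trans (equivalent⇒sameHeads o₁ o₂ p v) (equivalent⇒sameHeads o₂ o₃ q v)
      }
    }

  BO/Eulerian : Setoid 0ℓ 0ℓ
  BO/Eulerian = On.setoid orientationSetoid (proj₁ {B = BO G})

module _ {n m : ℕ} (G : Graph n m) (_≼_ : Rel (Fin m) 0ℓ) where

  IsInternallyActive : Subset m → Fin m → Set
  IsInternallyActive F f =
    f ∈ F × (∀ e → IsSpanningTree G ((F - f) ∪ ⁅ e ⁆) → f ≼ e)

  treesWithoutInternallyActiveEdge : Setoid 0ℓ 0ℓ
  treesWithoutInternallyActiveEdge = On.setoid (setoid (Subset m))
    (proj₁ {B = λ F → IsSpanningTree G F × (∀ f → ¬ IsInternallyActive F f)})

-- The quotient of S by its equality has exactly k elements.
HasCardinality : Setoid 0ℓ 0ℓ → ℕ → Set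
HasCardinality S k = Inverse S (setoid (Fin k))

-- ℕ[y][x]: the j-th entry of the i-th entry is the coefficient of xⁱyʲ.
Poly : Set
Poly = List (List ℕ)

addWith : {A : Set} → (A → A → A) → List A → List A → List A
addWith _∙_ []       bs       = bs
addWith _∙_ (a ∷ as) []       = a ∷ as
addWith _∙_ (a ∷ as) (b ∷ bs) = (a ∙ b) ∷ addWith _∙_ as bs

infixl 6 _⊞_

_⊞_ : Poly → Poly → Poly
_⊞_ = addWith (addWith _+_)

one : Poly
one = (1 ∷ []) ∷ []

x·_ y·_ : Poly → Poly
x· p = [] ∷ p
y· p = List.map (0 ∷_) p

eval : Poly → ℕ → ℕ → ℕ
eval p x y = foldr (λ c r → foldr (λ a s → a + y * s) 0 c + x * r) 0 p

-- Identifies t with s.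
merge : ∀ {n} (s t : Fin (suc n)) → t ≢ s → Fin (suc n) → Fin n
merge s t t≢s v with t ≟ v
... | yes _  = punchOut t≢s
... | no t≢v = punchOut t≢v

delete : ∀ {n m} → Graph n (suc m) → Fin (suc m) → Graph n m
delete G e = record { src = src G ∘ punchIn e ; tgt = tgt G ∘ punchIn e }

contract : ∀ {n m} (G : Graph (suc n) (suc m)) (e : Fin (suc m)) →
           ¬ IsLoop G e → Graph n m
contract G e ¬loop = record
  { src = identify ∘ src G ∘ punchIn e
  ; tgt = identify ∘ tgt G ∘ punchIn e
  }
  where identify = merge (src G e) (tgt G e) (¬loop ∘ sym)

-- IsTutte G T: T is obtained from G by deletion and contraction, the
-- edge being chosen arbitrarily at each stage.
data IsTutte : ∀ {n m} → Graph n m → Poly → Set where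
  edgeless : ∀ {n} {G : Graph n 0} → IsTutte G one
  bridge   : ∀ {n m T} {G : Graph (suc n) (suc m)} e (¬loop : ¬ IsLoop G e) →
             IsBridge G e →
             IsTutte (contract G e ¬loop) T → IsTutte G (x· T)
  loop     : ∀ {n m T} {G : Graph n (suc m)} e → IsLoop G e →
             IsTutte (delete G e) T → IsTutte G (y· T)
  ordinary : ∀ {n m T T′} {G : Graph (suc n) (suc m)} e (¬loop : ¬ IsLoop G e) →
             ¬ IsBridge G e →
             IsTutte (delete G e) T → IsTutte (contract G e ¬loop) T′ →
             IsTutte G (T ⊞ T′)

{-# OPTIONS --safe #-}
-- Reversing directed cycles does not change which sides of cuts are
-- entered, so strongness is a property of the Eulerian class, and a
-- class is determined by the number of heads in each vertex set.  Both
-- the classes of strong orientations and the trees without internally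
-- active edge satisfy the deletion-contraction recursion of T(0,1).
--
-- For classes, let e = st be neither a loop nor a bridge.  The classes
-- of G with a given contraction differ only by shifting heads between
-- s and t, and form a chain.  A class other than the one with fewest
-- heads at t stays strong after e is removed from a representative that
-- directs e from s to t; the remaining one accounts for the class of
-- the contraction.
--
-- For trees, take for e the largest edge: it has no influence on the
-- activity of other edges and is itself active only if it is a bridge.

module Submission where

open import Defs
import Algebra.Properties.CommutativeMonoid.Sum as CommutativeMonoidSum
open import Data.Bool.Base using (Bool; true; false; not; _∧_; _∨_; _xor_; if_then_else_)
import Data.Bool.Properties as Bool
open import Data.Fin.Base using (Fin; zero; suc; punchIn; punchOut)
open import Data.Fin.Permutation using (↔⇒≡)
open import Data.Fin.Properties as Fin using (_≟_; any?; all?; punchIn-punchOut; punchInᵢ≢i; punchIn-injective; punchOut-punchIn; punchOut-cong; +↔⊎)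
open import Data.Fin.Subset using (Subset; _∈_; _∉_; _⊆_; _⊂_; _∪_; ∁; ⁅_⁆; ⊤; _-_; ∣_∣; Nonempty; Empty)
open import Data.Fin.Subset.Induction using (⊃-wellFounded; ⊂-wellFounded; Acc; acc)
open import Data.Fin.Subset.Properties
open import Data.List.Base using (List; []; _∷_; allFin; foldr)
open import Data.List.Membership.Propositional using () renaming (_∈_ to _∈ₗ_)
open import Data.List.Membership.Propositional.Properties using (∈-allFin)
open import Data.List.Relation.Unary.All as All using (All; []; _∷_)
open import Data.List.Relation.Unary.AllPairs using ([]; _∷_)
open import Data.List.Relation.Unary.Any using (here; there)
open import Data.List.Relation.Unary.Unique.Propositional using (Unique)
open import Data.Nat.Base using (ℕ; zero; suc; _+_; _*_; _<_; _≤_; z≤n; s≤s)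
import Data.Nat.Properties as ℕ
open import Algebra.Properties.CommutativeSemigroup ℕ.+-commutativeSemigroup using (interchange)
open import Data.Product.Base using (∃-syntax; Σ-syntax; _×_; _,_; proj₁; proj₂)
open import Data.Sum.Base using (_⊎_; inj₁; inj₂; [_,_]′)
open import Data.Sum.Function.Setoid using (_⊎-inverse_)
open import Data.Sum.Relation.Binary.Pointwise using (_⊎ₛ_; Pointwise-≡↔≡; inj₁; inj₂)
open import Data.Unit.Base using (tt) renaming (⊤ to Unit)
open import Data.Vec.Base using ([]; _∷_; lookup; tabulate; insertAt; removeAt; _[_]%=_)
open import Data.Vec.Properties using (lookup∘tabulate; lookup-zipWith; lookup-map; tabulate-cong; []=⇒lookup; lookup⇒[]=; insertAt-lookup; insertAt-punchIn; insertAt-removeAt; removeAt-insertAt; lookup∘updateAt; lookup∘updateAt′)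
open import Function.Base using (_∘_; case_of_; id)
open import Function.Bundles using (Bijection)
import Function.Construct.Composition as Compose
import Function.Construct.Symmetry as Symmetry
open import Function.Properties.Bijection using (Bijection⇒Inverse)
open import Level using (0ℓ)
open import Relation.Binary.Bundles using (Setoid)
open import Relation.Binary.Construct.Closure.ReflexiveTransitive using (ε; _◅_)
import Relation.Binary.Construct.On as On
open import Relation.Binary.Core using (Rel)
open import Relation.Binary.Definitions using (tri<; tri≈; tri>)
open import Relation.Binary.PropositionalEquality
open import Relation.Binary.Structures using (IsTotalOrder)
open import Relation.Nullary using (¬_; Dec; yes; no; does; contradiction)
open import Relation.Nullary.Decidable using (_×-dec_; _⊎-dec_; ¬?; dec-true; dec-false)
open CommutativeMonoidSum ℕ.+-0-commutativeMonoid using (sum; sum-remove; ∑-distrib-+; ∑-comm; sum-cong-≗; sum-replicate-zero)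

-- The two counts do not follow the same recursion. The classes can be counted along any derivation
-- of a polynomial, whereas the trees for a given order force the choice of the edge and so build a
-- derivation of their own. They meet because the number of classes belongs to the graph alone: all
-- polynomials derivable from G agree at (0,1), which is also why T(0,1) is well defined here.
--
-- Connectedness, trees, strongness and equivalence are all phrased through vertex sets, given as
-- Boolean functions. A set that does not separate the ends of e passes to the contraction and back,
-- so none of these notions requires surgery on walks or cycles.
--
-- The delicate point is the chain of classes over a class of the contraction. It must be nonempty,
-- which is where e not being a bridge enters; the number of heads at t must be a coordinate on it;
-- and its lowest member must be the only one that needs e. The last fact comes from counting: the
-- heads in a set S are the edges entering S together with the edges inside S, and the latter do not
-- depend on the orientation.

private
  variable
    n m k l : ℕ
    A B : Setoid 0ℓ 0ℓ

-- Cardinalities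

card-unique : HasCardinality A k → HasCardinality A l → k ≡ l
card-unique f g = ↔⇒≡ (Compose.inverse (Symmetry.inverse f) g)

card-⊎ : HasCardinality A k → HasCardinality B l → HasCardinality (A ⊎ₛ B) (k + l)
card-⊎ f g = Compose.inverse (f ⊎-inverse g)
  (Compose.inverse (Pointwise-≡↔≡ _ _) (Symmetry.inverse +↔⊎))

card-bijection : Bijection A B → HasCardinality A k → HasCardinality B k
card-bijection f g = Compose.inverse (Symmetry.inverse (Bijection⇒Inverse f)) g

card-empty : ¬ Setoid.Carrier A → HasCardinality A 0
card-empty ¬a = record
  { to = λ a → contradiction a ¬a ; from = λ () ; to-cong = λ {a} _ → contradiction a ¬a
  ; from-cong = λ { {()} } ; inverse = (λ { {()} }) , λ {a} _ → contradiction a ¬a }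

module _ {A C : Setoid 0ℓ 0ℓ} where
  private
    module A = Setoid A
    module C = Setoid C

  bijection : (f : A.Carrier → C.Carrier) →
    (∀ {x y} → x A.≈ y → f x C.≈ f y) → (∀ {x y} → f x C.≈ f y → x A.≈ y) →
    (∀ z → ∃[ x ] f x C.≈ z) → Bijection A C
  bijection f f-cong f-inj cover = record
    { to = f ; cong = f-cong
    ; bijective = f-inj , λ z → proj₁ (cover z) , λ q → C.trans (f-cong q) (proj₂ (cover z))
    }

module _ {A B C : Setoid 0ℓ 0ℓ} where
  private
    module A = Setoid A
    module B = Setoid B
    module C = Setoid C

  bijection-⊎ : (f : A.Carrier → C.Carrier) (g : B.Carrier → C.Carrier) →
    (∀ {x y} → x A.≈ y → f x C.≈ f y) → (∀ {x y} → f x C.≈ f y → x A.≈ y) →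
    (∀ {x y} → x B.≈ y → g x C.≈ g y) → (∀ {x y} → g x C.≈ g y → x B.≈ y) →
    (∀ x y → ¬ (f x C.≈ g y)) →
    (∀ z → (∃[ x ] f x C.≈ z) ⊎ (∃[ y ] g y C.≈ z)) →
    Bijection (A ⊎ₛ B) C
  bijection-⊎ f g f-cong f-inj g-cong g-inj disjoint cover = record
    { to = [ f , g ]′
    ; cong = λ { (inj₁ p) → f-cong p ; (inj₂ p) → g-cong p }
    ; bijective = injective , surjective
    }
    where
    injective : ∀ {x y} → [ f , g ]′ x C.≈ [ f , g ]′ y → Setoid._≈_ (A ⊎ₛ B) x y
    injective {inj₁ _} {inj₁ _} p = inj₁ (f-inj p)
    injective {inj₁ x} {inj₂ y} p = contradiction p (disjoint x y)
    injective {inj₂ y} {inj₁ x} p = contradiction (C.sym p) (disjoint x y)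
    injective {inj₂ _} {inj₂ _} p = inj₂ (g-inj p)
    surjective : ∀ z → ∃[ x ] (∀ {w} → Setoid._≈_ (A ⊎ₛ B) w x → [ f , g ]′ w C.≈ z)
    surjective z with cover z
    ... | inj₁ (x , p) = inj₁ x , λ { (inj₁ q) → C.trans (f-cong q) p }
    ... | inj₂ (y , p) = inj₂ y , λ { (inj₂ q) → C.trans (g-cong q) p }

-- Counting

bit : Bool → ℕ
bit b = if b then 1 else 0

# : (Fin m → Bool) → ℕ
# p = sum (bit ∘ p)

#-split : {p q r : Fin m → Bool} → (∀ e → bit (p e) ≡ bit (q e) + bit (r e)) → # p ≡ # q + # r
#-split {q = q} {r} h = trans (sum-cong-≗ h) (∑-distrib-+ (bit ∘ q) (bit ∘ r))

#-positive : (p : Fin m → Bool) → 0 < # p → ∃[ e ] p e ≡ true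
#-positive {suc m} p pos with p zero in eq
... | true  = zero , eq
... | false = let e , pe = #-positive (p ∘ suc) pos in suc e , pe

positive-# : (p : Fin m → Bool) (e : Fin m) → p e ≡ true → 0 < # p
positive-# {suc m} p e pe = subst (0 <_)
  (sym (trans (sum-remove {i = e} (bit ∘ p)) (cong (λ b → bit b + # (p ∘ punchIn e)) pe)))
  (s≤s z≤n)

∣tabulate∣ : (p : Fin m → Bool) → ∣ tabulate p ∣ ≡ # p
∣tabulate∣ {zero}  p = refl
∣tabulate∣ {suc m} p with p zero
... | true  = cong suc (∣tabulate∣ (p ∘ suc))
... | false = ∣tabulate∣ (p ∘ suc)

data AroundView (e : Fin (suc m)) : Fin (suc m) → Set where
  here  : AroundView e e
  there : ∀ f → AroundView e (punchIn e f)

aroundView : (e f : Fin (suc m)) → AroundView e f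
aroundView e f with e ≟ f
... | yes refl = here
... | no e≢f = subst (AroundView e) (punchIn-punchOut e≢f) (there (punchOut e≢f))

-- Growing a set of vertices

∈⇒lookup : ∀ {S : Subset n} {x} → x ∈ S → lookup S x ≡ true
∈⇒lookup = []=⇒lookup

lookup⇒∈ : ∀ {S : Subset n} {x} → lookup S x ≡ true → x ∈ S
lookup⇒∈ {S = S} {x} = lookup⇒[]= x S

∉⇒lookup : ∀ {S : Subset n} {x} → x ∉ S → lookup S x ≡ false
∉⇒lookup x∉S = Bool.¬-not (x∉S ∘ lookup⇒∈)

lookup⇒∉ : ∀ {S : Subset n} {x} → lookup S x ≡ false → x ∉ S
lookup⇒∉ eq x∈S = case trans (sym eq) (∈⇒lookup x∈S) of λ ()

-- `P S x` is a certificate for `x` that lives inside `S`. Since a vertex is only added while it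
-- lies outside `S`, `grow` may use its freshness; this yields simple paths at once, with no need to
-- shorten walks. The complement of `S` shrinks, which gives termination.
module _ {_⟶_ : Rel (Fin n) 0ℓ} (_⟶?_ : ∀ x y → Dec (x ⟶ y))
  (P : Subset n → Fin n → Set)
  (mono : ∀ {S S′ x} → S ⊆ S′ → P S x → P S′ x)
  (grow : ∀ {S x y} → x ∈ S → y ∉ S → x ⟶ y → P S x → P (S ∪ ⁅ y ⁆) y) where

  private
    Saturated : Fin n → Set
    Saturated u = ∃[ S ] u ∈ S × (∀ {x} → x ∈ S → P S x) × (∀ {x y} → x ∈ S → x ⟶ y → y ∈ S)

    saturateFrom : ∀ {u} S → Acc (λ p q → q ⊂ p) S → u ∈ S → (∀ {x} → x ∈ S → P S x) → Saturated u
    saturateFrom S (acc rec) u∈S inv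
      with any? (λ x → any? (λ y → (x ∈? S) ×-dec (¬? (y ∈? S)) ×-dec (x ⟶? y)))
    ... | yes (x , y , x∈S , y∉S , x⟶y) =
      saturateFrom (S ∪ ⁅ y ⁆)
        (rec (p⊆p∪q ⁅ y ⁆ , y , q⊆p∪q S ⁅ y ⁆ (x∈⁅x⁆ y) , y∉S))
        (p⊆p∪q ⁅ y ⁆ u∈S)
        λ z∈ → case x∈p∪q⁻ S ⁅ y ⁆ z∈ of λ where
          (inj₁ z∈S) → mono (p⊆p∪q ⁅ y ⁆) (inv z∈S)
          (inj₂ z∈y) → subst (P _) (sym (x∈⁅y⁆⇒x≡y y z∈y)) (grow x∈S y∉S x⟶y (inv x∈S))
    ... | no closed = S , u∈S , inv , λ {x} {y} x∈S x⟶y → case y ∈? S of λ where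
      (yes y∈S) → y∈S
      (no y∉S)  → contradiction (x , y , x∈S , y∉S , x⟶y) closed

  saturate : ∀ {u} → P ⁅ u ⁆ u → Saturated u
  saturate {u} base = saturateFrom ⁅ u ⁆ (⊃-wellFounded _) (x∈⁅x⁆ u)
    λ x∈ → subst (P _) (sym (x∈⁅y⁆⇒x≡y u x∈)) base

-- Membership in small sets and exclusive or

lookup-⁅⁆ : ∀ (f h : Fin m) → lookup ⁅ f ⁆ h ≡ does (h ≟ f)
lookup-⁅⁆ f h with h ≟ f
... | yes refl = ∈⇒lookup (x∈⁅x⁆ h)
... | no h≢f   = ∉⇒lookup (x≢y⇒x∉⁅y⁆ h≢f)

lookup-- : ∀ (F : Subset m) f h → lookup (F - f) h ≡ lookup F h ∧ not (does (h ≟ f))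
lookup-- (x ∷ F) zero    zero    = sym (Bool.∧-zeroʳ x)
lookup-- (x ∷ F) zero    (suc h) =
  trans (cong (λ p → lookup p h) (p─⊥≡p F)) (sym (Bool.∧-identityʳ _))
lookup-- (x ∷ F) (suc f) zero    = sym (Bool.∧-identityʳ x)
lookup-- (x ∷ F) (suc f) (suc h) = lookup-- F f h

x∉p-x : ∀ (p : Subset m) x → x ∉ p - x
x∉p-x p x = lookup⇒∉ (trans (lookup-- p x x)
  (trans (cong (λ b → lookup p x ∧ not b) (dec-true (x ≟ x) refl)) (Bool.∧-zeroʳ _)))

≢⇒xor : ∀ x y → x ≢ y → x xor y ≡ true
≢⇒xor true  true  x≢y = contradiction refl x≢y
≢⇒xor true  false x≢y = refl
≢⇒xor false true  x≢y = refl
≢⇒xor false false x≢y = contradiction refl x≢y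

xor⇒≢ : ∀ x y → x xor y ≡ true → x ≢ y
xor⇒≢ true  true  () refl
xor⇒≢ false false () refl

xor-not : ∀ a b → not a xor not b ≡ a xor b
xor-not true  b = refl
xor-not false b = Bool.not-involutive b

true≢false : ∀ {x y} → x ≡ true → y ≡ false → x ≢ y
true≢false refl refl ()

-- Cuts, connectedness and spanning trees

crosses : Graph n m → (Fin n → Bool) → Fin m → Bool
crosses G S e = S (src G e) xor S (tgt G e)

-- If `χ` is a spanning tree containing `f`, the edges crossing such an `S` form the fundamental cut
-- of `f`.
OnlyCrossing : Graph n m → (Fin m → Bool) → (Fin n → Bool) → Fin m → Set
OnlyCrossing G χ S f = crosses G S f ≡ true × (∀ g → χ g ≡ true → crosses G S g ≡ true → g ≡ f)

CutConnected : Graph n m → (Fin m → Bool) → Set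
CutConnected G χ = ∀ S {u v} → S u ≡ true → S v ≡ false → ∃[ e ] χ e ≡ true × crosses G S e ≡ true

-- Every edge of χ is a bridge of χ.
Independent : Graph n m → (Fin m → Bool) → Set
Independent G χ = ∀ f → χ f ≡ true → ∃[ S ] OnlyCrossing G χ S f

-- Both conditions speak of vertex sets, because these transfer directly: every set of a contraction
-- pulls back, and a set pushes forward as soon as it does not separate the ends of `e`. As a
-- Boolean function, `χ` restricts to a minor by composition with `punchIn e`.
Tree : Graph n m → (Fin m → Bool) → Set
Tree G χ = CutConnected G χ × Independent G χ

module _ (G : Graph n m) {χ χ′ : Fin m → Bool} (χ≗χ′ : χ ≗ χ′) where

  OnlyCrossing-resp : ∀ {S f} → OnlyCrossing G χ S f → OnlyCrossing G χ′ S f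
  OnlyCrossing-resp (f× , only) = f× , λ g g∈χ′ → only g (trans (χ≗χ′ g) g∈χ′)

  Tree-resp : Tree G χ → Tree G χ′
  Tree-resp (conn , indep) =
    (λ S u v → let e , e∈χ , e× = conn S u v in e , trans (sym (χ≗χ′ e)) e∈χ , e×) ,
    (λ f f∈χ′ → let S , only = indep f (trans (χ≗χ′ f) f∈χ′) in S , OnlyCrossing-resp {S} only)

module _ (G : Graph n m) where

  Joins : Fin m → Fin n → Fin n → Set
  Joins e u v = (src G e ≡ u × tgt G e ≡ v) ⊎ (src G e ≡ v × tgt G e ≡ u)

  joins-sym : ∀ {e u v} → Joins e u v → Joins e v u
  joins-sym (inj₁ p) = inj₂ p
  joins-sym (inj₂ p) = inj₁ p

  joins? : ∀ e u v → Dec (Joins e u v)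
  joins? e u v = ((src G e ≟ u) ×-dec (tgt G e ≟ v)) ⊎-dec ((src G e ≟ v) ×-dec (tgt G e ≟ u))

  joins-crosses : ∀ S {e u v} → Joins e u v → S u ≢ S v → crosses G S e ≡ true
  joins-crosses S (inj₁ (refl , refl)) u≢v = ≢⇒xor _ _ u≢v
  joins-crosses S (inj₂ (refl , refl)) u≢v = ≢⇒xor _ _ (u≢v ∘ sym)

  crosses-true : ∀ S e → crosses G S e ≡ true →
                 ∃[ u ] ∃[ v ] Joins e u v × S u ≡ true × S v ≡ false
  crosses-true S e e× with S (src G e) in s | S (tgt G e) in t
  ... | true  | false = src G e , tgt G e , inj₁ (refl , refl) , s , t
  ... | false | true  = tgt G e , src G e , inj₂ (refl , refl) , t , s

  -- That the edge lies on the walk itself is recorded for `independent⇒acyclic`, where it must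
  -- differ from the first edge of the cycle.
  walk-crosses : ∀ {F u v} S (w : Walk G F u v) → S u ≢ S v →
                 ∃[ e ] e ∈ F × crosses G S e ≡ true × e ∈ₗ walkEdges G w
  walk-crosses S ε u≢v = contradiction refl u≢v
  walk-crosses {u = u} S (_◅_ {j = w} (step e e∈F j) walk) u≢v with S u Bool.≟ S w
  ... | yes u≡w = let f , f∈F , f× , f∈w = walk-crosses S walk (u≢v ∘ trans u≡w)
                  in  f , f∈F , f× , there f∈w
  ... | no u≢w  = e , e∈F , joins-crosses S j u≢w , here refl

  connectedBy⇒cutConnected : ∀ {F} → ConnectedBy G F → CutConnected G (lookup F)
  connectedBy⇒cutConnected conn S u v =
    let e , e∈F , e× , _ = walk-crosses S (conn _ _) (true≢false u v) in e , ∈⇒lookup e∈F , e×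

  -- Paths grow at their start and all end in `v`. Confining vertices and edges to `S` makes
  -- whatever is attached at a vertex outside `S` fresh, and `y ≢ v` keeps `v` free to be the base
  -- when the path is closed to a cycle. `Q` can exclude an edge.
  record SimplePath (F : Subset m) (Q : Fin m → Set) (S : Subset n) (v x : Fin n) : Set where
    field
      walk            : Walk G F x v
      target          : v ∈ S
      vertices        : All (λ y → y ∈ S × y ≢ v) (walkVertices G walk)
      unique-vertices : Unique (walkVertices G walk)
      edges           : All (λ e → Q e × src G e ∈ S × tgt G e ∈ S) (walkEdges G walk)
      unique-edges    : Unique (walkEdges G walk)

  -- S is the set of vertices from which v can be reached.
  simplePaths : ∀ F {Q : Fin m → Set} (Q? : ∀ e → Dec (Q e)) v →
    ∃[ S ] v ∈ S × (∀ {x} → x ∈ S → SimplePath F Q S v x) ×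
           (∀ {x y e} → x ∈ S → e ∈ F → Q e → Joins e y x → y ∈ S)
  simplePaths F {Q} Q? v =
    let S , v∈S , path , closed = saturate back? (λ S → SimplePath F Q S v) mono grow base
    in  S , v∈S , path , λ x∈S e∈F q j → closed x∈S (_ , e∈F , q , j)
    where
    Back : Fin n → Fin n → Set
    Back x y = ∃[ e ] e ∈ F × Q e × Joins e y x
    back? : ∀ x y → Dec (Back x y)
    back? x y = any? λ e → (e ∈? F) ×-dec Q? e ×-dec joins? e y x
    mono : ∀ {S S′ x} → S ⊆ S′ → SimplePath F Q S v x → SimplePath F Q S′ v x
    mono S⊆S′ p = record
      { SimplePath p
      ; target   = S⊆S′ (SimplePath.target p)
      ; vertices = All.map (λ (y∈S , y≢v) → S⊆S′ y∈S , y≢v) (SimplePath.vertices p)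
      ; edges    = All.map (λ (q , s , t) → q , S⊆S′ s , S⊆S′ t) (SimplePath.edges p)
      }
    base : SimplePath F Q ⁅ v ⁆ v v
    base = record { walk = ε ; target = x∈⁅x⁆ v ; vertices = [] ; unique-vertices = []
                  ; edges = [] ; unique-edges = [] }
    grow : ∀ {S x y} → x ∈ S → y ∉ S → Back x y → SimplePath F Q S v x →
           SimplePath F Q (S ∪ ⁅ y ⁆) v y
    grow {S} {x} {y} x∈S y∉S (e , e∈F , q , j) p = record
      { walk            = step e e∈F j ◅ walk
      ; target          = old target
      ; vertices        = (new , λ { refl → y∉S target }) ∷
                          All.map (λ (z∈S , z≢v) → old z∈S , z≢v) vertices
      ; unique-vertices = All.map (λ { (z∈S , _) refl → y∉S z∈S }) vertices ∷ unique-vertices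
      ; edges           = (q , ends j) ∷ All.map (λ (q′ , s , t) → q′ , old s , old t) edges
      ; unique-edges    = All.map (λ { (_ , s , t) refl → outside j s t }) edges ∷ unique-edges
      }
      where
      open SimplePath p
      old : ∀ {z} → z ∈ S → z ∈ S ∪ ⁅ y ⁆
      old = p⊆p∪q ⁅ y ⁆
      new : y ∈ S ∪ ⁅ y ⁆
      new = q⊆p∪q S ⁅ y ⁆ (x∈⁅x⁆ y)
      ends : Joins e y x → src G e ∈ S ∪ ⁅ y ⁆ × tgt G e ∈ S ∪ ⁅ y ⁆
      ends (inj₁ (refl , refl)) = new , old x∈S
      ends (inj₂ (refl , refl)) = old x∈S , new
      outside : Joins e y x → src G e ∈ S → tgt G e ∈ S → _
      outside (inj₁ (refl , refl)) s t = y∉S s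
      outside (inj₂ (refl , refl)) s t = y∉S t

  cutConnected⇒connectedBy : ∀ {F} → CutConnected G (lookup F) → ConnectedBy G F
  cutConnected⇒connectedBy {F} conn u v with simplePaths F {λ _ → Unit} (λ _ → yes tt) v
  ... | S , v∈S , path , closed with u ∈? S
  ... | yes u∈S = SimplePath.walk (path u∈S)
  ... | no u∉S  =
    let e , e∈F , e× = conn (lookup S) (∈⇒lookup v∈S) (∉⇒lookup u∉S)
        x , y , j , x∈S , y∉S = crosses-true (lookup S) e e×
    in  contradiction (closed (lookup⇒∈ x∈S) (lookup⇒∈ e∈F) tt (joins-sym j)) (lookup⇒∉ y∉S)

  separates⇒onlyCrossing : ∀ {F f} S → src G f ∉ S → tgt G f ∈ S →
    (∀ {x y e} → x ∈ S → e ∈ F → e ≢ f → Joins e y x → y ∈ S) →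
    OnlyCrossing G (lookup F) (lookup S) f
  separates⇒onlyCrossing {F} {f} S s∉S t∈S closed =
    joins-crosses (lookup S) {f} (inj₂ (refl , refl)) (true≢false (∈⇒lookup t∈S) (∉⇒lookup s∉S)) , only
    where
    only : ∀ g → lookup F g ≡ true → crosses G (lookup S) g ≡ true → g ≡ f
    only g g∈F g× with g ≟ f
    ... | yes g≡f = g≡f
    ... | no g≢f  =
      let x , y , j , x∈S , y∉S = crosses-true (lookup S) g g×
      in  contradiction (closed (lookup⇒∈ x∈S) (lookup⇒∈ g∈F) g≢f (joins-sym j)) (lookup⇒∉ y∉S)

  -- The vertices that reach the target of `f` without using `f` form one side of a cut. If the
  -- source of `f` is among them, its simple path together with `f` is a cycle; for a loop `f` the
  -- path is empty.
  acyclic⇒independent : ∀ {F} → ¬ Cycle G F → Independent G (lookup F)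
  acyclic⇒independent {F} acyclic f f∈F
    with simplePaths F (λ e → ¬? (e ≟ f)) (tgt G f)
  ... | S , t∈S , path , closed with src G f ∈? S
  ... | no s∉S  = lookup S , separates⇒onlyCrossing S s∉S t∈S closed
  ... | yes s∈S = contradiction cycle acyclic
    where
    open SimplePath (path s∈S)
    cycle : Cycle G F
    cycle = record
      { base            = tgt G f
      ; walk            = step f (lookup⇒∈ f∈F) (inj₂ (refl , refl)) ◅ walk
      ; nonempty        = λ ()
      ; unique-edges    = All.map (λ (e≢f , _) f≡e → e≢f (sym f≡e)) edges ∷ unique-edges
      ; unique-vertices = All.map (λ (_ , y≢v) v≡y → y≢v (sym v≡y)) vertices ∷ unique-vertices
      }

  -- What remains of a cycle after its first edge `f` still joins the ends of `f`, so it crosses the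
  -- cut that isolates `f`. It can do so only in `f`, which occurs just once.
  independent⇒acyclic : ∀ {F} → Independent G (lookup F) → ¬ Cycle G F
  independent⇒acyclic indep record { walk = ε ; nonempty = nonempty } = nonempty refl
  independent⇒acyclic indep record { walk = step f f∈F j ◅ walk ; unique-edges = f∉walk ∷ _ } =
    let S , f× , only = indep f (∈⇒lookup f∈F)
        e , e∈F , e× , e∈walk = walk-crosses S walk (ends-differ S j f× ∘ sym)
    in  All.lookup f∉walk e∈walk (sym (only e (∈⇒lookup e∈F) e×))
    where
    ends-differ : ∀ S {e u v} → Joins e u v → crosses G S e ≡ true → S u ≢ S v
    ends-differ S (inj₁ (refl , refl)) e× = xor⇒≢ _ _ e×
    ends-differ S (inj₂ (refl , refl)) e× = xor⇒≢ _ _ e× ∘ sym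

  spanningTree⇒tree : ∀ {F} → IsSpanningTree G F → Tree G (lookup F)
  spanningTree⇒tree (conn , acyclic) = connectedBy⇒cutConnected conn , acyclic⇒independent acyclic

  tree⇒spanningTree : ∀ {F} → Tree G (lookup F) → IsSpanningTree G F
  tree⇒spanningTree (conn , indep) = cutConnected⇒connectedBy conn , independent⇒acyclic indep

  CutConnected-⊤ : Connected G → CutConnected G (λ _ → true)
  CutConnected-⊤ conn S u v =
    let e , _ , e× = connectedBy⇒cutConnected conn S u v in e , refl , e×

  -- `IsBridge` is a negation; this dichotomy supplies a positive witness on either side and thereby
  -- decides it.
  separated⊎joined : ∀ e → (∃[ S ] OnlyCrossing G (λ _ → true) S e) ⊎ Walk G (⊤ - e) (src G e) (tgt G e)
  separated⊎joined e with simplePaths (⊤ - e) {λ _ → Unit} (λ _ → yes tt) (tgt G e)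
  ... | S , t∈S , path , closed with src G e ∈? S
  ... | yes s∈S = inj₂ (SimplePath.walk (path s∈S))
  ... | no s∉S  =
    let e× , only = separates⇒onlyCrossing {⊤} {e} S s∉S t∈S
                      (λ x∈S _ e′≢e j → closed x∈S (x∈p∧x≢y⇒x∈p-y ∈⊤ e′≢e) tt j)
    in  inj₁ (lookup S , e× , λ g _ → only g (∈⇒lookup (∈⊤ {x = g})))

  onlyCrossing⇒bridge : ∀ {S e} → OnlyCrossing G (λ _ → true) S e → IsBridge G e
  onlyCrossing⇒bridge {S} {e} (e× , only) w =
    let f , f∈ , f× , _ = walk-crosses S w (xor⇒≢ _ _ e×)
    in  x∉p-x ⊤ e (subst (_∈ ⊤ - e) (only f refl f×) f∈)

  bridge⇒onlyCrossing : ∀ {e} → IsBridge G e → ∃[ S ] OnlyCrossing G (λ _ → true) S e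
  bridge⇒onlyCrossing {e} isBridge = [ id , (λ w → contradiction w isBridge) ]′ (separated⊎joined e)

-- Deletion and contraction

module _ (s t : Fin (suc n)) (t≢s : t ≢ s) where

  merge-punchIn : ∀ v → merge s t t≢s (punchIn t v) ≡ v
  merge-punchIn v with t ≟ punchIn t v
  ... | yes t≡v = contradiction (sym t≡v) (punchInᵢ≢i t v)
  ... | no t≢v  = trans (punchOut-cong t refl) (punchOut-punchIn t)

  merge-ends : merge s t t≢s s ≡ merge s t t≢s t
  merge-ends with t ≟ s | t ≟ t
  ... | yes t≡s | _       = contradiction t≡s t≢s
  ... | no _    | yes _   = punchOut-cong t refl
  ... | no _    | no t≢t  = contradiction refl t≢t

  factor : (S : Fin (suc n) → Bool) → S s ≡ S t → ∀ v → S (punchIn t (merge s t t≢s v)) ≡ S v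
  factor S s≡t v with t ≟ v
  ... | yes refl = trans (cong S (punchIn-punchOut t≢s)) s≡t
  ... | no t≢v   = cong S (punchIn-punchOut t≢v)

xor-false : ∀ x y → x xor y ≡ false → x ≡ y
xor-false true  true  _ = refl
xor-false false false _ = refl

not-crossing : ∀ (G : Graph n m) {χ S f g} → OnlyCrossing G χ S f → χ g ≡ true → g ≢ f →
               crosses G S g ≡ false
not-crossing G (_ , only) g∈χ g≢f = Bool.¬-not (g≢f ∘ only _ g∈χ)

-- The space of cuts

infixl 6 _⊕_

_⊕_ : (Fin n → Bool) → (Fin n → Bool) → Fin n → Bool
(S ⊕ T) v = S v xor T v

xor-interchange : ∀ a b c d → (a xor b) xor (c xor d) ≡ (a xor c) xor (b xor d)
xor-interchange true  true  true  d = refl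
xor-interchange true  true  false d = sym (Bool.not-involutive d)
xor-interchange true  false true  d = Bool.not-involutive d
xor-interchange true  false false d = refl
xor-interchange false true  true  d = refl
xor-interchange false true  false d = refl
xor-interchange false false c     d = refl

-- Linearity over the two-element field: the cut of a symmetric difference is the symmetric
-- difference of the cuts. The exchange arguments for trees add cuts in this way.
crosses-⊕ : ∀ (G : Graph n m) S T e → crosses G (S ⊕ T) e ≡ crosses G S e xor crosses G T e
crosses-⊕ G S T e = xor-interchange (S (src G e)) (T (src G e)) (S (tgt G e)) (T (tgt G e))

crosses-⊕ˡ : ∀ (G : Graph n m) S T {e b} → crosses G S e ≡ b → crosses G T e ≡ false →
             crosses G (S ⊕ T) e ≡ b
crosses-⊕ˡ G S T {e} {b} S× T× =
  trans (crosses-⊕ G S T e) (trans (cong₂ _xor_ S× T×) (Bool.xor-identityʳ b))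

crosses-⊕-both : ∀ (G : Graph n m) S T {e} → crosses G S e ≡ true → crosses G T e ≡ true →
                 crosses G (S ⊕ T) e ≡ false
crosses-⊕-both G S T {e} S× T× = trans (crosses-⊕ G S T e) (cong₂ _xor_ S× T×)

-- Trees of the two minors

module _ (G : Graph n (suc m)) (e : Fin (suc m)) {χ : Fin (suc m) → Bool} (e∉χ : χ e ≡ false) where

  tree-delete⁺ : Tree G χ → Tree (delete G e) (χ ∘ punchIn e)
  tree-delete⁺ (conn , indep) = conn′ , indep′
    where
    conn′ : CutConnected (delete G e) (χ ∘ punchIn e)
    conn′ S u v with conn S u v
    ... | f , f∈χ , f× with aroundView e f
    ... | here    = contradiction e∉χ (true≢false f∈χ refl)
    ... | there f = f , f∈χ , f×
    indep′ : Independent (delete G e) (χ ∘ punchIn e)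
    indep′ f f∈χ =
      let S , f× , only = indep (punchIn e f) f∈χ
      in  S , f× , λ g g∈χ g× → punchIn-injective e g f (only (punchIn e g) g∈χ g×)

  tree-delete⁻ : Tree (delete G e) (χ ∘ punchIn e) → Tree G χ
  tree-delete⁻ (conn , indep) = conn′ , indep′
    where
    conn′ : CutConnected G χ
    conn′ S u v = let f , f∈χ , f× = conn S u v in punchIn e f , f∈χ , f×
    indep′ : Independent G χ
    indep′ f f∈χ with aroundView e f
    ... | here    = contradiction e∉χ (true≢false f∈χ refl)
    ... | there f with indep f f∈χ
    ...   | S , f× , only = S , f× , only′
      where
      only′ : ∀ g → χ g ≡ true → crosses G S g ≡ true → g ≡ punchIn e f
      only′ g g∈χ g× with aroundView e g
      ... | here    = contradiction e∉χ (true≢false g∈χ refl)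
      ... | there g = cong (punchIn e) (only g g∈χ g×)

module Contraction (G : Graph (suc n) (suc m)) (e : Fin (suc m)) (¬loop : ¬ IsLoop G e) where

  identify : Fin (suc n) → Fin n
  identify = merge (src G e) (tgt G e) (¬loop ∘ sym)

  section : Fin n → Fin (suc n)
  section = punchIn (tgt G e)

  identify-section : ∀ v → identify (section v) ≡ v
  identify-section = merge-punchIn _ _ (¬loop ∘ sym)

  identify-ends : identify (src G e) ≡ identify (tgt G e)
  identify-ends = merge-ends _ _ (¬loop ∘ sym)

  section-identify : ∀ S → S (src G e) ≡ S (tgt G e) → ∀ v → S (section (identify v)) ≡ S v
  section-identify = factor _ _ (¬loop ∘ sym)

  pull-not-crossing : ∀ S → crosses G (S ∘ identify) e ≡ false
  pull-not-crossing S = trans (cong (λ v → S v xor S (identify (tgt G e))) identify-ends)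
                              (Bool.xor-same (S (identify (tgt G e))))

  push-crosses : ∀ S → S (src G e) ≡ S (tgt G e) → ∀ f →
                 crosses (contract G e ¬loop) (S ∘ section) f ≡ crosses G S (punchIn e f)
  push-crosses S s≡t f = cong₂ _xor_ (section-identify S s≡t _) (section-identify S s≡t _)

  cutConnected-contract : ∀ {χ} → CutConnected G χ →
                          CutConnected (contract G e ¬loop) (χ ∘ punchIn e)
  cutConnected-contract conn S {u} {v} u∈S v∉S
    with conn (S ∘ identify) (trans (cong S (identify-section u)) u∈S)
                             (trans (cong S (identify-section v)) v∉S)
  ... | f , f∈χ , f× with aroundView e f
  ... | here    = contradiction (pull-not-crossing S) (true≢false f× refl)
  ... | there f = f , f∈χ , f×

  module _ {χ : Fin (suc m) → Bool} (e∈χ : χ e ≡ true) where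

    -- The cut that isolates another tree edge misses the tree edge `e`, so its side does not
    -- separate the ends of `e` and survives the contraction.
    tree-contract⁺ : Tree G χ → Tree (contract G e ¬loop) (χ ∘ punchIn e)
    tree-contract⁺ (conn , indep) = cutConnected-contract conn , indep′
      where
      indep′ : Independent (contract G e ¬loop) (χ ∘ punchIn e)
      indep′ f f∈χ =
        let S , only@(f× , only′) = indep (punchIn e f) f∈χ
            s≡t = xor-false _ _ (not-crossing G {S = S} only e∈χ (punchInᵢ≢i e f ∘ sym))
        in  S ∘ section , trans (push-crosses S s≡t f) f× ,
            λ g g∈χ g× → punchIn-injective e g f
              (only′ (punchIn e g) g∈χ (trans (sym (push-crosses S s≡t g)) g×))

    tree-contract⁻ : Tree (contract G e ¬loop) (χ ∘ punchIn e) → Tree G χ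
    tree-contract⁻ (conn , indep) = conn′ , indep′
      where
      conn′ : CutConnected G χ
      conn′ S {u} {v} u∈S v∉S with crosses G S e in eq
      ... | true  = e , e∈χ , eq
      ... | false =
        let s≡t = xor-false _ _ eq
            f , f∈χ , f× = conn (S ∘ section) (trans (section-identify S s≡t u) u∈S)
                                              (trans (section-identify S s≡t v) v∉S)
        in  punchIn e f , f∈χ , trans (sym (push-crosses S s≡t f)) f×

      -- In the space of cuts, subtracting from any cut through e the
      -- cuts that isolate the edges of the contracted tree leaves a cut
      -- that contains e and avoids all these edges.
      eliminate : (fs : List (Fin m)) →
        ∃[ S ] crosses G S e ≡ true ×
               (∀ {f} → f ∈ₗ fs → χ (punchIn e f) ≡ true → crosses G S (punchIn e f) ≡ false)
      -- The cut around the source of `e` contains `e` because `e` is not a loop.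
      eliminate [] = (λ v → does (v ≟ src G e)) ,
        cong₂ _xor_ (dec-true (src G e ≟ _) refl) (dec-false (tgt G e ≟ src G e) (¬loop ∘ sym)) ,
        λ ()
      eliminate (f ∷ fs) with eliminate fs
      ... | S , e× , avoids with χ (punchIn e f) in f∈χ | crosses G S (punchIn e f) in f×
      ...   | false | _     = S , e× , λ where
        (here refl) g∈χ → contradiction f∈χ (true≢false g∈χ refl)
        (there g∈fs)    → avoids g∈fs
      ...   | true  | false = S , e× , λ where
        (here refl) _ → f×
        (there g∈fs)  → avoids g∈fs
      ...   | true  | true  with indep f f∈χ
      ...     | T , only@(f×T , _) =
        S ⊕ T ∘ identify , crosses-⊕ˡ G S (T ∘ identify) e× (pull-not-crossing T) , avoids′
        where
        avoids′ : ∀ {g} → g ∈ₗ f ∷ fs → χ (punchIn e g) ≡ true →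
                  crosses G (S ⊕ T ∘ identify) (punchIn e g) ≡ false
        avoids′ (here refl) _ = crosses-⊕-both G S (T ∘ identify) f× f×T
        avoids′ {g} (there g∈fs) g∈χ with g ≟ f
        ... | yes refl = crosses-⊕-both G S (T ∘ identify) f× f×T
        ... | no g≢f   = crosses-⊕ˡ G S (T ∘ identify) (avoids g∈fs g∈χ)
          (not-crossing (contract G e ¬loop) {χ = χ ∘ punchIn e} {S = T} only g∈χ g≢f)

      indep′ : Independent G χ
      indep′ f f∈χ with aroundView e f
      indep′ _ _ | here with eliminate (allFin m)
      ... | S , e× , avoids = S , e× , only
        where
        only : ∀ g → χ g ≡ true → crosses G S g ≡ true → g ≡ e
        only g g∈χ g× with aroundView e g
        ... | here    = refl
        ... | there g = contradiction (avoids (∈-allFin g) g∈χ) (true≢false g× refl)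
      indep′ _ f∈χ | there f with indep f f∈χ
      ... | S , f× , only = S ∘ identify , f× , only′
        where
        only′ : ∀ g → χ g ≡ true → crosses G (S ∘ identify) g ≡ true → g ≡ punchIn e f
        only′ g g∈χ g× with aroundView e g
        ... | here    = contradiction (pull-not-crossing S) (true≢false g× refl)
        ... | there g = cong (punchIn e) (only g g∈χ g×)

-- Internal activity

totalOrder-on : (f : Fin k → Fin l) → (∀ {x y} → f x ≡ f y → x ≡ y) →
                {_≼_ : Rel (Fin l) 0ℓ} → IsTotalOrder _≡_ _≼_ →
                IsTotalOrder _≡_ (λ x y → f x ≼ f y)
totalOrder-on f f-inj ≼-total = record
  { isPartialOrder = record
    { isPreorder = record
      { isEquivalence = isEquivalence
      ; reflexive     = IsTotalOrder.reflexive ≼-total ∘ cong f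
      ; trans         = IsTotalOrder.trans ≼-total
      }
    ; antisym = λ p q → f-inj (IsTotalOrder.antisym ≼-total p q)
    }
  ; total = λ x y → IsTotalOrder.total ≼-total (f x) (f y)
  }


exchange : (Fin m → Bool) → Fin m → Fin m → Fin m → Bool
exchange χ f g h = (χ h ∧ not (does (h ≟ f))) ∨ does (h ≟ g)

exchange-new : ∀ (χ : Fin m → Bool) f g → exchange χ f g g ≡ true
exchange-new χ f g = trans (cong (χ g ∧ not (does (g ≟ f)) ∨_) (dec-true (g ≟ g) refl)) (Bool.∨-zeroʳ _)

exchange-old : ∀ (χ : Fin m → Bool) {f} g {h} → χ h ≡ true → h ≢ f → exchange χ f g h ≡ true
exchange-old χ {f} g {h} h∈χ h≢f = cong₂ (λ a b → (a ∧ not b) ∨ does (h ≟ g)) h∈χ (dec-false (h ≟ f) h≢f)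

exchange-true : ∀ (χ : Fin m → Bool) f g h → exchange χ f g h ≡ true →
                h ≡ g ⊎ (χ h ≡ true × h ≢ f)
exchange-true χ f g h eq with h ≟ g | h ≟ f | χ h
exchange-true χ f g h eq | yes h≡g | _      | _    = inj₁ h≡g
exchange-true χ f g h eq | no _    | no h≢f | true = inj₂ (refl , h≢f)

does-≟-punchIn : ∀ (e : Fin (suc m)) f g → does (punchIn e f ≟ punchIn e g) ≡ does (f ≟ g)
does-≟-punchIn e f g with f ≟ g
... | yes refl = dec-true (punchIn e f ≟ punchIn e f) refl
... | no f≢g   = dec-false (punchIn e f ≟ punchIn e g) (f≢g ∘ punchIn-injective e f g)

exchange-punchIn : ∀ (χ : Fin (suc m) → Bool) e f g →
                   exchange χ (punchIn e f) (punchIn e g) ∘ punchIn e ≗ exchange (χ ∘ punchIn e) f g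
exchange-punchIn χ e f g h =
  cong₂ (λ a b → (χ (punchIn e h) ∧ not a) ∨ b) (does-≟-punchIn e h f) (does-≟-punchIn e h g)

exchange-outside : ∀ (χ : Fin (suc m) → Bool) e f g →
                   exchange χ (punchIn e f) (punchIn e g) e ≡ χ e
exchange-outside χ e f g = trans
  (cong₂ (λ a b → (χ e ∧ not a) ∨ b) (dec-false (e ≟ punchIn e f) (punchInᵢ≢i e f ∘ sym))
                                     (dec-false (e ≟ punchIn e g) (punchInᵢ≢i e g ∘ sym)))
  (trans (Bool.∨-identityʳ _) (Bool.∧-identityʳ _))

lookup-exchange : ∀ (F : Subset m) f g → lookup ((F - f) ∪ ⁅ g ⁆) ≗ exchange (lookup F) f g
lookup-exchange F f g h = trans (lookup-zipWith _∨_ h (F - f) ⁅ g ⁆)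
                                (cong₂ _∨_ (lookup-- F f h) (lookup-⁅⁆ g h))

module _ (G : Graph n m) (_≼_ : Rel (Fin m) 0ℓ) where

  Active : (Fin m → Bool) → Fin m → Set
  Active χ f = χ f ≡ true × (∀ g → Tree G (exchange χ f g) → f ≼ g)

  InactiveTree : (Fin m → Bool) → Set
  InactiveTree χ = Tree G χ × (∀ f → ¬ Active χ f)

  inactiveTrees : Setoid 0ℓ 0ℓ
  inactiveTrees = On.setoid (setoid (Subset m)) (proj₁ {B = λ F → InactiveTree (lookup F)})

  inactiveTrees-bijection : Bijection inactiveTrees (treesWithoutInternallyActiveEdge G _≼_)
  inactiveTrees-bijection = bijection
    (λ (F , tree , inactive) → F , tree⇒spanningTree G tree , λ f (f∈F , least) →
      inactive f (∈⇒lookup f∈F , λ g t → least g (tree⇒spanningTree G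
        (Tree-resp G (λ h → sym (lookup-exchange F f g h)) t))))
    id id
    (λ (F , tree , inactive) → (F , spanningTree⇒tree G tree , λ f (f∈F , least) →
      inactive f (lookup⇒∈ f∈F , λ g t → least g
        (Tree-resp G (lookup-exchange F f g) (spanningTree⇒tree G t)))) , refl)

-- This serves both minors: `H` is the deletion when `b` is `false` and the contraction when `b` is
-- `true`. Only `inactive-e` differs in substance: an edge outside the tree is never active, while
-- one inside needs a replacement.
module Extension {n k} (G : Graph n (suc m)) (H : Graph k m) (e : Fin (suc m)) (b : Bool)
  (tree⁺ : ∀ {χ} → χ e ≡ b → Tree G χ → Tree H (χ ∘ punchIn e))
  (tree⁻ : ∀ {χ} → χ e ≡ b → Tree H (χ ∘ punchIn e) → Tree G χ)
  (_≼_ : Rel (Fin (suc m)) 0ℓ) (greatest : ∀ f → f ≼ e)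
  (inactive-e : ∀ {χ} → Tree G χ → χ e ≡ b → ¬ Active G _≼_ χ e) where

  private
    _≼′_ : Rel (Fin m) 0ℓ
    f ≼′ g = punchIn e f ≼ punchIn e g

  active⁺ : ∀ {χ} → χ e ≡ b → ∀ {f} → Active G _≼_ χ (punchIn e f) → Active H _≼′_ (χ ∘ punchIn e) f
  active⁺ {χ} χe {f} (f∈χ , least) = f∈χ , λ g tree → least (punchIn e g)
    (tree⁻ (trans (exchange-outside χ e f g) χe)
      (Tree-resp H (λ h → sym (exchange-punchIn χ e f g h)) tree))

  active⁻ : ∀ {χ} → χ e ≡ b → ∀ {f} → Active H _≼′_ (χ ∘ punchIn e) f → Active G _≼_ χ (punchIn e f)
  active⁻ {χ} χe {f} (f∈χ , least) = f∈χ , least′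
    where
    least′ : ∀ g → Tree G (exchange χ (punchIn e f) g) → punchIn e f ≼ g
    least′ g tree with aroundView e g
    -- An exchange that brings in `e` has no counterpart in `H`; it imposes no constraint because
    -- `e` is the greatest edge.
    ... | here    = greatest (punchIn e f)
    ... | there g = least g (Tree-resp H (exchange-punchIn χ e f g)
                              (tree⁺ (trans (exchange-outside χ e f g) χe) tree))

  inactiveTree⁺ : ∀ {χ} → χ e ≡ b → InactiveTree G _≼_ χ → InactiveTree H _≼′_ (χ ∘ punchIn e)
  inactiveTree⁺ {χ} χe (tree , inactive) =
    tree⁺ χe tree , λ f active → inactive (punchIn e f) (active⁻ χe active)

  inactiveTree⁻ : ∀ {χ} → χ e ≡ b → InactiveTree H _≼′_ (χ ∘ punchIn e) → InactiveTree G _≼_ χ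
  inactiveTree⁻ {χ} χe (tree , inactive) = tree⁻ χe tree , inactive′
    where
    inactive′ : ∀ f → ¬ Active G _≼_ χ f
    inactive′ f active with aroundView e f
    ... | here    = inactive-e (tree⁻ χe tree) χe active
    ... | there f = inactive f (active⁺ χe active)

  InactiveTree-resp : ∀ {χ χ′} → χ ≗ χ′ → InactiveTree H _≼′_ χ → InactiveTree H _≼′_ χ′
  InactiveTree-resp {χ} {χ′} χ≗χ′ (tree , inactive) = Tree-resp H χ≗χ′ tree , λ f (f∈χ′ , least) →
    inactive f (trans (χ≗χ′ f) f∈χ′ , λ g t → least g (Tree-resp H
      (λ h → cong (λ c → (c ∧ not (does (h ≟ f))) ∨ does (h ≟ g)) (χ≗χ′ h)) t))

  extend : Setoid.Carrier (inactiveTrees H _≼′_) → Setoid.Carrier (inactiveTrees G _≼_)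
  extend (F , tree) = insertAt F e b ,
    inactiveTree⁻ (insertAt-lookup F e b) (InactiveTree-resp (λ f → sym (insertAt-punchIn F e b f)) tree)

  extend-injective : ∀ {F F′} → insertAt F e b ≡ insertAt F′ e b → F ≡ F′
  extend-injective {F} {F′} eq = begin
    F                             ≡⟨ removeAt-insertAt F e b ⟨
    removeAt (insertAt F e b) e   ≡⟨ cong (λ F → removeAt F e) eq ⟩
    removeAt (insertAt F′ e b) e  ≡⟨ removeAt-insertAt F′ e b ⟩
    F′                            ∎
    where open ≡-Reasoning

  extend-cover : (F : Setoid.Carrier (inactiveTrees G _≼_)) → lookup (proj₁ F) e ≡ b →
                 Σ[ F′ ∈ Setoid.Carrier (inactiveTrees H _≼′_) ] insertAt (proj₁ F′) e b ≡ proj₁ F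
  extend-cover (F , tree) eq =
    (removeAt F e , InactiveTree-resp restrict (inactiveTree⁺ eq tree)) , insert-remove
    where
    insert-remove : insertAt (removeAt F e) e b ≡ F
    insert-remove = trans (cong (insertAt _ e) (sym eq)) (insertAt-removeAt F e)
    restrict : lookup F ∘ punchIn e ≗ lookup (removeAt F e)
    restrict f = trans (cong (λ F → lookup F (punchIn e f)) (sym insert-remove))
                       (insertAt-punchIn (removeAt F e) e b f)

-- Exchange along a fundamental cut

module _ {G : Graph n (suc m)} {e : Fin (suc m)} (conn : CutConnected (delete G e) (λ _ → true)) where

  -- Deleting e from a spanning tree leaves the cut S; any other edge g
  -- of this cut can replace e.
  replacement : ∀ {χ} → Tree G χ → χ e ≡ true → ∃[ g ] g ≢ e × Tree G (exchange χ e g)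
  replacement {χ} (connχ , indep) e∈χ
    with indep e e∈χ
  ... | S , only@(e× , only′) with crosses-true G S e e×
  ... | u , v , _ , u∈S , v∉S with conn S u∈S v∉S
  ... | g′ , _ , g× = g , punchInᵢ≢i e g′ , conn′ , indep′
    where
    g : Fin (suc m)
    g = punchIn e g′

    conn′ : CutConnected G (exchange χ e g)
    conn′ T x∈T y∉T with connχ T x∈T y∉T
    ... | f , f∈χ , f× with f ≟ e
    ... | no f≢e   = f , exchange-old χ g f∈χ f≢e , f×
    ... | yes refl with crosses G T g in g×T
    ...   | true  = g , exchange-new χ e g , g×T
    -- The cut of `T` contains `e` but not `g`, so that of `S ⊕ T` contains `g` but not `e`. It is
    -- therefore nonempty and meets the tree in some `h` other than `e`; as `h` does not cross `S`,
    -- it crosses `T`.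
    ...   | false with crosses-true G (S ⊕ T) g (crosses-⊕ˡ G S T g× g×T)
    ...     | x , y , _ , x∈ , y∉ with connχ (S ⊕ T) x∈ y∉
    ...       | h , h∈χ , h× with h ≟ e
    ...         | yes refl = contradiction (crosses-⊕-both G S T e× f×) (true≢false h× refl)
    ...         | no h≢e   = h , exchange-old χ g h∈χ h≢e ,
      trans (sym (trans (crosses-⊕ G S T h) (cong (_xor crosses G T h) (not-crossing G {S = S} only h∈χ h≢e)))) h×

    indep′ : Independent G (exchange χ e g)
    indep′ f f∈ with exchange-true χ e g f f∈
    ... | inj₁ refl = S , g× , λ h h∈ h× → case exchange-true χ e g h h∈ of λ where
      (inj₁ h≡g)         → h≡g
      (inj₂ (h∈χ , h≢e)) → contradiction (only′ h h∈χ h×) h≢e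
    ... | inj₂ (f∈χ , f≢e) with indep f f∈χ
    ...   | T , f×T , onlyT with crosses G T g in g×T
    ...     | false = T , f×T , λ h h∈ h× → case exchange-true χ e g h h∈ of λ where
      (inj₁ refl)      → contradiction g×T (true≢false h× refl)
      (inj₂ (h∈χ , _)) → onlyT h h∈χ h×
    -- The cut isolating `f` now also contains `g`. Adding the cut of `S` expels `g` and keeps `f`,
    -- since `e` is the only edge of the old tree in it.
    ...     | true  = T ⊕ S , crosses-⊕ˡ G T S f×T (not-crossing G {S = S} only f∈χ f≢e) ,
      λ h h∈ h× → case exchange-true χ e g h h∈ of λ where
        (inj₁ refl)        → contradiction (crosses-⊕-both G T S g×T g×) (true≢false h× refl)
        (inj₂ (h∈χ , h≢e)) → onlyT h h∈χ (xor-cancel h (not-crossing G {S = S} only h∈χ h≢e) h×)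
      where
      xor-cancel : ∀ h → crosses G S h ≡ false → crosses G (T ⊕ S) h ≡ true → crosses G T h ≡ true
      xor-cancel h h×S h× = trans (sym (crosses-⊕ˡ G T S refl h×S)) h×

-- Loops, bridges and connectedness after deletion

loop-not-crossing : ∀ (G : Graph n m) S {e} → IsLoop G e → crosses G S e ≡ false
loop-not-crossing G S {e} isLoop = trans (cong (λ v → S v xor S (tgt G e)) isLoop) (Bool.xor-same (S (tgt G e)))

tree-loop : ∀ {G : Graph n m} {χ e} → Tree G χ → IsLoop G e → χ e ≡ false
tree-loop {G = G} {χ} {e} (_ , indep) isLoop = Bool.¬-not λ e∈χ →
  let S , e× , _ = indep e e∈χ in true≢false e× (loop-not-crossing G S isLoop) refl

module _ {G : Graph n (suc m)} (conn : CutConnected G (λ _ → true)) where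

  cutConnected-delete : ∀ {e} → Walk G (⊤ - e) (src G e) (tgt G e) → CutConnected (delete G e) (λ _ → true)
  cutConnected-delete {e} w S u∈S v∉S with conn S u∈S v∉S
  ... | f , _ , f× with aroundView e f
  ... | there f = f , refl , f×
  ... | here with walk-crosses G S w (xor⇒≢ _ _ f×)
  ...   | g , g∈ , g× , _ with aroundView e g
  ...     | here    = contradiction g∈ (x∉p-x ⊤ e)
  ...     | there g = g , refl , g×

  cutConnected-nonbridge : ∀ {e} → ¬ IsBridge G e → CutConnected (delete G e) (λ _ → true)
  cutConnected-nonbridge {e} ¬bridge with separated⊎joined G e
  ... | inj₁ (S , only) = contradiction (onlyCrossing⇒bridge G {S} only) ¬bridge
  ... | inj₂ w          = cutConnected-delete w

  bridge? : ∀ e → Dec (IsBridge G e)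
  bridge? e with separated⊎joined G e
  ... | inj₁ (S , only) = yes (onlyCrossing⇒bridge G {S} only)
  ... | inj₂ w          = no λ isBridge → isBridge w

  cutConnected-loop : ∀ {e} → IsLoop G e → CutConnected (delete G e) (λ _ → true)
  cutConnected-loop {e} isLoop S u∈S v∉S with conn S u∈S v∉S
  ... | f , _ , f× with aroundView e f
  ... | here    = contradiction (loop-not-crossing G S isLoop) (true≢false f× refl)
  ... | there f = f , refl , f×

-- Evaluating the Tutte polynomial

evalRow : List ℕ → ℕ
evalRow = foldr (λ a s → a + 1 * s) 0

evalRow-⊞ : ∀ p q → evalRow (addWith _+_ p q) ≡ evalRow p + evalRow q
evalRow-⊞ []      q       = refl
evalRow-⊞ (a ∷ p) []      = sym (ℕ.+-identityʳ _)
evalRow-⊞ (a ∷ p) (b ∷ q) = begin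
  a + b + 1 * evalRow (addWith _+_ p q)        ≡⟨ cong (λ s → a + b + 1 * s) (evalRow-⊞ p q) ⟩
  a + b + 1 * (evalRow p + evalRow q)          ≡⟨ cong (a + b +_) (ℕ.*-distribˡ-+ 1 (evalRow p) _) ⟩
  a + b + (1 * evalRow p + 1 * evalRow q)      ≡⟨ interchange a b _ _ ⟩
  a + 1 * evalRow p + (b + 1 * evalRow q)      ∎
  where open ≡-Reasoning

-- Since 0 ^ i vanishes for positive i, only the first row contributes.
eval₀₁ : Poly → ℕ
eval₀₁ []      = 0
eval₀₁ (c ∷ _) = evalRow c

eval-0-1 : ∀ T → eval T 0 1 ≡ eval₀₁ T
eval-0-1 []      = refl
eval-0-1 (c ∷ T) = ℕ.+-identityʳ _

eval₀₁-⊞ : ∀ T T′ → eval₀₁ (T ⊞ T′) ≡ eval₀₁ T + eval₀₁ T′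
eval₀₁-⊞ []      T′       = refl
eval₀₁-⊞ (c ∷ T) []       = sym (ℕ.+-identityʳ _)
eval₀₁-⊞ (c ∷ T) (d ∷ T′) = evalRow-⊞ c d

eval₀₁-y : ∀ T → eval₀₁ (y· T) ≡ eval₀₁ T
eval₀₁-y []      = refl
eval₀₁-y (c ∷ T) = ℕ.*-identityˡ (evalRow c)

-- Counting trees

greatest : (_≼_ : Rel (Fin (suc m)) 0ℓ) → IsTotalOrder _≡_ _≼_ → ∃[ e ] (∀ f → f ≼ e)
greatest {zero}  _≼_ ≼-total = zero , λ { zero → IsTotalOrder.refl ≼-total }
greatest {suc m} _≼_ ≼-total with greatest (λ f g → suc f ≼ suc g) (totalOrder-on suc Fin.suc-injective ≼-total)
... | e , max with IsTotalOrder.total ≼-total zero (suc e)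
... | inj₁ 0≼e = suc e , λ { zero → 0≼e ; (suc f) → max f }
... | inj₂ e≼0 = zero , λ { zero → IsTotalOrder.refl ≼-total ; (suc f) → IsTotalOrder.trans ≼-total (max f) e≼0 }

module _ (G : Graph n (suc m)) (e : Fin (suc m)) (_≼_ : Rel (Fin (suc m)) 0ℓ) (max : ∀ f → f ≼ e) where

  private
    _≼′_ : Rel (Fin m) 0ℓ
    f ≼′ g = punchIn e f ≼ punchIn e g

    module Deletion = Extension G (delete G e) e false (tree-delete⁺ G e) (tree-delete⁻ G e)
      _≼_ max (λ _ e∉χ (e∈χ , _) → true≢false e∈χ e∉χ refl)

  inactiveTrees-loop : IsLoop G e → Bijection (inactiveTrees (delete G e) _≼′_) (inactiveTrees G _≼_)
  inactiveTrees-loop isLoop = bijection Deletion.extend (cong _) Deletion.extend-injective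
    λ F → Deletion.extend-cover F (tree-loop {G = G} (proj₁ (proj₂ F)) isLoop)

-- A bridge is the only edge of its own fundamental cut, hence active.
inactiveTrees-bridge : ∀ (G : Graph n m) (_≼_ : Rel (Fin m) 0ℓ) → IsTotalOrder _≡_ _≼_ →
                       ∀ {e} → IsBridge G e → ¬ Setoid.Carrier (inactiveTrees G _≼_)
inactiveTrees-bridge G _≼_ ≼-total {e} isBridge (F , tree , inactive)
  with bridge⇒onlyCrossing G isBridge
... | S , e× , only = inactive e (in-tree tree , least)
  where
  in-tree : ∀ {χ} → Tree G χ → χ e ≡ true
  in-tree {χ} (conn , _) =
    let u , v , _ , u∈S , v∉S = crosses-true G S e e×
        f , f∈χ , f× = conn S u∈S v∉S
    in  trans (cong χ (sym (only f refl f×))) f∈χ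
  least : ∀ g → Tree G (exchange (lookup F) e g) → e ≼ g
  least g tree′ with exchange-true (lookup F) e g e (in-tree tree′)
  ... | inj₁ e≡g       = IsTotalOrder.reflexive ≼-total e≡g
  ... | inj₂ (_ , e≢e) = contradiction refl e≢e

module _ (G : Graph (suc n) (suc m)) (e : Fin (suc m)) (_≼_ : Rel (Fin (suc m)) 0ℓ)
  (≼-total : IsTotalOrder _≡_ _≼_) (max : ∀ f → f ≼ e)
  (¬loop : ¬ IsLoop G e) (conn : CutConnected (delete G e) (λ _ → true)) where

  private
    _≼′_ : Rel (Fin m) 0ℓ
    f ≼′ g = punchIn e f ≼ punchIn e g

    module Deletion = Extension G (delete G e) e false (tree-delete⁺ G e) (tree-delete⁻ G e)
      _≼_ max (λ _ e∉χ (e∈χ , _) → true≢false e∈χ e∉χ refl)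

    largest-inactive : ∀ {χ} → Tree G χ → χ e ≡ true → ¬ Active G _≼_ χ e
    largest-inactive tree e∈χ (_ , least) =
      let g , g≢e , tree′ = replacement {G = G} conn tree e∈χ
      in  g≢e (IsTotalOrder.antisym ≼-total (max g) (least g tree′))

    module Contracted = Extension G (contract G e ¬loop) e true
      (Contraction.tree-contract⁺ G e ¬loop) (Contraction.tree-contract⁻ G e ¬loop)
      _≼_ max largest-inactive

  inactiveTrees-ordinary : Bijection
    (inactiveTrees (delete G e) _≼′_ ⊎ₛ inactiveTrees (contract G e ¬loop) _≼′_) (inactiveTrees G _≼_)
  inactiveTrees-ordinary = bijection-⊎ Deletion.extend Contracted.extend
    (cong _) Deletion.extend-injective (cong _) Contracted.extend-injective disjoint cover
    where
    disjoint : ∀ F F′ → insertAt (proj₁ F) e false ≢ insertAt (proj₁ F′) e true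
    disjoint (F , _) (F′ , _) eq = true≢false (insertAt-lookup F′ e true) (insertAt-lookup F e false)
      (cong (λ F → lookup F e) (sym eq))
    cover : ∀ F → (∃[ F′ ] insertAt (proj₁ F′) e false ≡ proj₁ F) ⊎ (∃[ F′ ] insertAt (proj₁ F′) e true ≡ proj₁ F)
    cover F with lookup (proj₁ F) e in eq
    ... | false = inj₁ (Deletion.extend-cover F eq)
    ... | true  = inj₂ (Contracted.extend-cover F eq)

inactiveTrees-edgeless : ∀ (G : Graph n 0) (_≼_ : Rel (Fin 0) 0ℓ) → CutConnected G (λ _ → true) →
                         HasCardinality (inactiveTrees G _≼_) 1
inactiveTrees-edgeless G _≼_ conn = record
  { to        = λ _ → zero
  ; from      = λ _ → [] , ((λ S u∈S v∉S → case conn S u∈S v∉S of λ ()) , λ ()) , λ ()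
  ; to-cong   = λ _ → refl
  ; from-cong = λ _ → refl
  ; inverse   = (λ { {zero} _ → refl }) , λ { {[] , _} _ → refl }
  }

evaluates : ∀ {A : Setoid 0ℓ 0ℓ} {k} T → HasCardinality A k → k ≡ eval₀₁ T → HasCardinality A (eval T 0 1)
evaluates {A} T card eq = subst (HasCardinality A) (trans eq (sym (eval-0-1 T))) card

eval-⊞ : ∀ T T′ → eval T 0 1 + eval T′ 0 1 ≡ eval₀₁ (T ⊞ T′)
eval-⊞ T T′ = trans (cong₂ _+_ (eval-0-1 T) (eval-0-1 T′)) (sym (eval₀₁-⊞ T T′))

eval-y : ∀ T → eval T 0 1 ≡ eval₀₁ (y· T)
eval-y T = trans (eval-0-1 T) (sym (eval₀₁-y T))

-- The polynomial is produced together with the count because the recursion has to remove the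
-- largest edge every time; a prescribed derivation may choose its edges otherwise.
tutte-trees : ∀ (G : Graph n m) → CutConnected G (λ _ → true) →
              ∀ (_≼_ : Rel (Fin m) 0ℓ) → IsTotalOrder _≡_ _≼_ →
              ∃[ T ] IsTutte G T × HasCardinality (inactiveTrees G _≼_) (eval T 0 1)
tutte-trees {m = zero} G conn _≼_ _ = one , edgeless , inactiveTrees-edgeless G _≼_ conn
tutte-trees {zero} {suc m} G = case src G zero of λ ()
tutte-trees {suc n} {suc m} G conn _≼_ ≼-total
  with greatest _≼_ ≼-total
... | e , max with src G e ≟ tgt G e
... | yes isLoop =
  let T , isT , card = tutte-trees (delete G e) (cutConnected-loop {G = G} conn isLoop) _ ≼′-total
  in  y· T , loop e isLoop isT ,
      evaluates (y· T) (card-bijection (inactiveTrees-loop G e _≼_ max isLoop) card) (eval-y T)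
  where ≼′-total = totalOrder-on (punchIn e) (punchIn-injective e _ _) ≼-total
... | no ¬loop with bridge? {G = G} conn e
-- The contraction only supplies the derivation here: `eval (x· T) 0 1` computes to 0, and there are
-- no trees to count.
...   | yes isBridge =
  let T , isT , _ = tutte-trees (contract G e ¬loop)
        (Contraction.cutConnected-contract G e ¬loop conn) _ ≼′-total
  in  x· T , bridge e ¬loop isBridge isT , card-empty (inactiveTrees-bridge G _≼_ ≼-total isBridge)
  where ≼′-total = totalOrder-on (punchIn e) (punchIn-injective e _ _) ≼-total
...   | no ¬bridge =
  let conn′ = cutConnected-nonbridge {G = G} conn ¬bridge
      T  , isT  , card  = tutte-trees (delete G e) conn′ _ ≼′-total
      T′ , isT′ , card′ = tutte-trees (contract G e ¬loop)
        (Contraction.cutConnected-contract G e ¬loop conn) _ ≼′-total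
  in  T ⊞ T′ , ordinary e ¬loop ¬bridge isT isT′ ,
      evaluates (T ⊞ T′) (card-bijection (inactiveTrees-ordinary G e _≼_ ≼-total max ¬loop conn′) (card-⊎ card card′))
                (eval-⊞ T T′)
  where ≼′-total = totalOrder-on (punchIn e) (punchIn-injective e _ _) ≼-total

-- Orientations and indegrees

headsIn : Graph n m → Orientation m → (Fin n → Bool) → ℕ
headsIn G o S = # (S ∘ head G o)

-- The counts at single vertices determine all of these. Sets are used since contraction and
-- `Strong` are expressed through them.
SameHeads : Graph n m → Rel (Orientation m) 0ℓ
SameHeads G o₁ o₂ = ∀ S → headsIn G o₁ S ≡ headsIn G o₂ S

-- Applied to the complement, the condition also gives an edge leaving `S`.
Strong : Graph n m → Orientation m → Set
Strong {n} G o = ∀ (S : Fin n → Bool) {u v} → S u ≡ true → S v ≡ false →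
             ∃[ e ] S (head G o e) ≡ true × S (tail G o e) ≡ false

Trap : Graph n m → Orientation m → (Fin n → Bool) → Set
Trap G o S = (∃[ u ] S u ≡ true) × (∃[ v ] S v ≡ false) ×
             (∀ e → ¬ (S (head G o e) ≡ true × S (tail G o e) ≡ false))

bit-delta : ∀ (S : Fin n → Bool) x → bit (S x) ≡ sum (λ v → bit (S v ∧ does (x ≟ v)))
bit-delta {suc n} S x = sym (begin
  sum (λ v → bit (S v ∧ does (x ≟ v)))
    ≡⟨ sum-remove {i = x} (λ v → bit (S v ∧ does (x ≟ v))) ⟩
  bit (S x ∧ does (x ≟ x)) + sum (λ v → bit (S (punchIn x v) ∧ does (x ≟ punchIn x v)))
    ≡⟨ cong₂ _+_ (cong bit (trans (cong (S x ∧_) (dec-true (x ≟ x) refl)) (Bool.∧-identityʳ _)))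
                 (sum-cong-≗ λ v → cong bit (trans (cong (S (punchIn x v) ∧_)
                   (dec-false (x ≟ punchIn x v) (punchInᵢ≢i x v ∘ sym))) (Bool.∧-zeroʳ _))) ⟩
  bit (S x) + sum {n} (λ _ → 0)
    ≡⟨ cong (bit (S x) +_) (sum-replicate-zero n) ⟩
  bit (S x) + 0
    ≡⟨ ℕ.+-identityʳ _ ⟩
  bit (S x) ∎)
  where open ≡-Reasoning

bit-split : ∀ a b → bit a ≡ bit (a ∧ not b) + bit (a ∧ b)
bit-split true  true  = refl
bit-split true  false = refl
bit-split false b     = refl

module _ (G : Graph n m) where

  headsIn-vertexwise : ∀ o S → headsIn G o S ≡ sum (λ v → if S v then ∣ headsAt G o v ∣ else 0)
  headsIn-vertexwise o S = begin
    sum (λ e → bit (S (head G o e)))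
      ≡⟨ sum-cong-≗ (λ e → bit-delta S (head G o e)) ⟩
    sum (λ e → sum (λ v → bit (S v ∧ does (head G o e ≟ v))))
      ≡⟨ ∑-comm (λ e v → bit (S v ∧ does (head G o e ≟ v))) ⟩
    sum (λ v → sum (λ e → bit (S v ∧ does (head G o e ≟ v))))
      ≡⟨ sum-cong-≗ at ⟩
    sum (λ v → if S v then ∣ headsAt G o v ∣ else 0) ∎
    where
    open ≡-Reasoning
    at : ∀ v → sum (λ e → bit (S v ∧ does (head G o e ≟ v))) ≡ (if S v then ∣ headsAt G o v ∣ else 0)
    at v with S v
    ... | true  = sym (∣tabulate∣ (λ e → does (head G o e ≟ v)))
    ... | false = sum-replicate-zero m

  sameHeads⇒eulerian : ∀ {o₁ o₂} → SameHeads G o₁ o₂ → EulerianEquivalent G o₁ o₂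
  sameHeads⇒eulerian {o₁} {o₂} same = sameHeads⇒equivalent G o₁ o₂ λ v →
    trans (∣tabulate∣ (λ e → does (head G o₁ e ≟ v)))
      (trans (same (λ x → does (x ≟ v))) (sym (∣tabulate∣ (λ e → does (head G o₂ e ≟ v)))))

  eulerian⇒sameHeads : ∀ {o₁ o₂} → EulerianEquivalent G o₁ o₂ → SameHeads G o₁ o₂
  eulerian⇒sameHeads {o₁} {o₂} eq S = trans (headsIn-vertexwise o₁ S)
    (trans (sum-cong-≗ (λ v → cong (λ d → if S v then d else 0) (equivalent⇒sameHeads G o₁ o₂ eq v)))
      (sym (headsIn-vertexwise o₂ S)))

  entering : Orientation m → (Fin n → Bool) → Fin m → Bool
  entering o S e = S (head G o e) ∧ not (S (tail G o e))

  -- The second summand, counting the edges inside `S`, does not depend on `o`. Hence comparing the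
  -- heads of two orientations in `S` compares their numbers of edges entering `S`.
  headsIn-split : ∀ o S → headsIn G o S ≡ # (entering o S) + # (λ e → S (src G e) ∧ S (tgt G e))
  headsIn-split o S = #-split pointwise
    where
    pointwise : ∀ e → bit (S (head G o e)) ≡ bit (entering o S e) + bit (S (src G e) ∧ S (tgt G e))
    pointwise e with lookup o e
    ... | true  = trans (bit-split (S (tgt G e)) (S (src G e)))
                        (cong (λ b → bit (S (tgt G e) ∧ not (S (src G e))) + bit b) (Bool.∧-comm (S (tgt G e)) (S (src G e))))
    ... | false = bit-split (S (src G e)) (S (tgt G e))

  entering⇒positive : ∀ o S {e} → S (head G o e) ≡ true → S (tail G o e) ≡ false → 0 < # (entering o S)
  entering⇒positive o S {e} h∈S t∉S = positive-# (entering o S) e (cong₂ (λ a b → a ∧ not b) h∈S t∉S)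

  positive⇒entering : ∀ o S → 0 < # (entering o S) →
                      ∃[ e ] S (head G o e) ≡ true × S (tail G o e) ≡ false
  positive⇒entering o S pos with #-positive (entering o S) pos
  ... | e , eq with S (head G o e) in h | S (tail G o e) in t
  ... | true | false = e , h , t

  entering-mono : ∀ o₁ o₂ S → headsIn G o₁ S ≤ headsIn G o₂ S → # (entering o₁ S) ≤ # (entering o₂ S)
  entering-mono o₁ o₂ S ≤ = ℕ.+-cancelʳ-≤ _ _ _
    (subst₂ _≤_ (headsIn-split o₁ S) (headsIn-split o₂ S) ≤)

  strong-resp : ∀ {o₁ o₂} → SameHeads G o₁ o₂ → Strong G o₁ → Strong G o₂
  strong-resp {o₁} {o₂} same strong S u∈S v∉S =
    let e , h∈S , t∉S = strong S u∈S v∉S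
    in  positive⇒entering o₂ S (ℕ.<-≤-trans (entering⇒positive o₁ S h∈S t∉S)
          (entering-mono o₁ o₂ S (ℕ.≤-reflexive (same S))))

  -- The search runs over `Subset n`, which is finite; a Boolean function is brought into its range
  -- by `tabulate`.
  strong⊎trap : ∀ o → Strong G o ⊎ (∃[ S ] Trap G o S)
  strong⊎trap o with anySubset? (λ p →
    any? (λ u → lookup p u Bool.≟ true) ×-dec any? (λ v → lookup p v Bool.≟ false) ×-dec
    all? (λ e → ¬? ((lookup p (head G o e) Bool.≟ true) ×-dec (lookup p (tail G o e) Bool.≟ false))))
  ... | yes (p , trap) = inj₂ (lookup p , trap)
  ... | no ¬trap       = inj₁ strong
    where
    strong : Strong G o
    strong S {u} {v} u∈S v∉S with any? (λ e → (S (head G o e) Bool.≟ true) ×-dec (S (tail G o e) Bool.≟ false))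
    ... | yes found = found
    ... | no ¬found = contradiction
      (tabulate S , (u , at u u∈S) , (v , at v v∉S) , λ e (h∈S , t∉S) → ¬found (e , at⁻ h∈S , at⁻ t∉S))
      ¬trap
      where
      at : ∀ x {b} → S x ≡ b → lookup (tabulate S) x ≡ b
      at x = trans (lookup∘tabulate S x)
      at⁻ : ∀ {x b} → lookup (tabulate S) x ≡ b → S x ≡ b
      at⁻ {x} = trans (sym (lookup∘tabulate S x))

  trap⇒¬strong : ∀ {o S} → Trap G o S → ¬ Strong G o
  trap⇒¬strong {S = S} ((u , u∈S) , (v , v∉S) , closed) strong =
    let e , entering = strong S u∈S v∉S in closed e entering

  head-cong : ∀ {o o′ e} → lookup o e ≡ lookup o′ e → head G o e ≡ head G o′ e
  head-cong {e = e} = cong (λ b → if b then tgt G e else src G e)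

  tail-cong : ∀ {o o′ e} → lookup o e ≡ lookup o′ e → tail G o e ≡ tail G o′ e
  tail-cong {e = e} = cong (λ b → if b then src G e else tgt G e)

-- Reversing an edge and a path

reverse : Orientation m → Fin m → Orientation m
reverse o e = o [ e ]%= not

head-reverse : ∀ (G : Graph n m) o e → head G (reverse o e) e ≡ tail G o e
head-reverse G o e rewrite lookup∘updateAt e {not} o with lookup o e
... | true  = refl
... | false = refl

headsIn-reverse : ∀ (G : Graph n m) o e S →
  headsIn G (reverse o e) S + bit (S (head G o e)) ≡ headsIn G o S + bit (S (tail G o e))
headsIn-reverse {m = suc m} G o e S = begin
  headsIn G (reverse o e) S + h
    ≡⟨ cong (_+ h) (sum-remove {i = e} (λ f → bit (S (head G (reverse o e) f)))) ⟩
  bit (S (head G (reverse o e) e)) + sum (λ f → bit (S (head G (reverse o e) (punchIn e f)))) + h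
    ≡⟨ cong (_+ h) (cong₂ _+_ (cong (bit ∘ S) (head-reverse G o e))
                              (sum-cong-≗ λ f → cong (bit ∘ S) (head-cong G {reverse o e} {o}
                                (lookup∘updateAt′ (punchIn e f) e (punchInᵢ≢i e f) o)))) ⟩
  t + r + h
    ≡⟨ cong (_+ h) (ℕ.+-comm t r) ⟩
  r + t + h
    ≡⟨ trans (ℕ.+-comm _ h) (sym (ℕ.+-assoc h r t)) ⟩
  h + r + t
    ≡⟨ cong (_+ t) (sum-remove {i = e} (λ f → bit (S (head G o f)))) ⟨
  headsIn G o S + t ∎
  where
  open ≡-Reasoning
  h t r : ℕ
  h = bit (S (head G o e))
  t = bit (S (tail G o e))
  r = sum (λ f → bit (S (head G o (punchIn e f))))

module _ (G : Graph n m) where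

  -- Reversing a path from `u` to `v` moves one head from `v` to `u`, whence `heads`. By `outside`,
  -- an arc to a vertex not in `S` still has its direction in `o` and can prolong the path. By
  -- `from-end`, an edge leaving `v` is not on the path, so it remains available to close a cycle.
  record Rerouted (o : Orientation m) (u : Fin n) (S : Subset n) (v : Fin n) : Set where
    field
      result   : Orientation m
      heads    : ∀ T → headsIn G result T + bit (T v) ≡ headsIn G o T + bit (T u)
      outside  : ∀ e → ¬ (src G e ∈ S × tgt G e ∈ S) → lookup result e ≡ lookup o e
      from-end : ∀ e → tail G o e ≡ v → lookup result e ≡ lookup o e

  -- Reversing a directed path from u to v.
  reroute : ∀ {o} → Strong G o → ∀ u v → ∃[ S ] Rerouted o u S v
  reroute {o} strong u v =
    let S , u∈S , rerouted , closed = saturate arc? (Rerouted o u) mono grow base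
    in  S , rerouted (everywhere u∈S closed)
    where
    Arc : Fin n → Fin n → Set
    Arc x y = ∃[ e ] tail G o e ≡ x × head G o e ≡ y
    arc? : ∀ x y → Dec (Arc x y)
    arc? x y = any? λ e → (tail G o e ≟ x) ×-dec (head G o e ≟ y)
    mono : ∀ {S S′ x} → S ⊆ S′ → Rerouted o u S x → Rerouted o u S′ x
    mono S⊆S′ r = record { Rerouted r ; outside = λ e e∉S′ →
      Rerouted.outside r e λ (s∈S , t∈S) → e∉S′ (S⊆S′ s∈S , S⊆S′ t∈S) }
    base : Rerouted o u ⁅ u ⁆ u
    base = record { result = o ; heads = λ T → refl ; outside = λ e _ → refl ; from-end = λ e _ → refl }
    ends : ∀ e (S : Subset n) → src G e ∈ S × tgt G e ∈ S → tail G o e ∈ S × head G o e ∈ S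
    ends e S (s∈S , t∈S) with lookup o e
    ... | true  = s∈S , t∈S
    ... | false = t∈S , s∈S
    ends⁻ : ∀ e (S : Subset n) → tail G o e ∈ S × head G o e ∈ S → src G e ∈ S × tgt G e ∈ S
    ends⁻ e S (s∈S , t∈S) with lookup o e
    ... | true  = s∈S , t∈S
    ... | false = t∈S , s∈S
    everywhere : ∀ {S : Subset n} → u ∈ S → (∀ {x y} → x ∈ S → Arc x y → y ∈ S) → v ∈ S
    everywhere {S} u∈S closed with v ∈? S
    ... | yes v∈S = v∈S
    ... | no v∉S  =
      -- An edge entering the complement of `S` is an arc leaving `S`.
      let e , h∉S , t∈S = strong (not ∘ lookup S) (cong not (∉⇒lookup v∉S)) (cong not (∈⇒lookup u∈S))
      in  contradiction (closed (lookup⇒∈ (Bool.not-injective t∈S)) (e , refl , refl))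
                        (lookup⇒∉ (Bool.not-injective h∉S))
    grow : ∀ {S x y} → x ∈ S → y ∉ S → Arc x y → Rerouted o u S x → Rerouted o u (S ∪ ⁅ y ⁆) y
    grow {S} {x} {y} x∈S y∉S (e , refl , refl) r = record
      { result   = reverse (result r) e
      ; heads    = heads′
      ; outside  = λ f f∉S′ → trans
          (lookup∘updateAt′ f e (λ { refl → f∉S′ (ends⁻ f _ (old x∈S , new)) }) (result r))
          (outside r f λ (s∈S , t∈S) → f∉S′ (old s∈S , old t∈S))
      ; from-end = λ f t≡y → trans
          (lookup∘updateAt′ f e (λ { refl → y∉S (subst (_∈ S) t≡y x∈S) }) (result r))
          (outside r f λ in-S → y∉S (subst (_∈ S) t≡y (proj₁ (ends f S in-S))))
      }
      where
      open Rerouted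
      old : ∀ {z} → z ∈ S → z ∈ S ∪ ⁅ y ⁆
      old = p⊆p∪q ⁅ y ⁆
      new : y ∈ S ∪ ⁅ y ⁆
      new = q⊆p∪q S ⁅ y ⁆ (x∈⁅x⁆ y)
      unchanged : lookup (result r) e ≡ lookup o e
      unchanged = outside r e λ in-S → y∉S (proj₂ (ends e S in-S))
      heads′ : ∀ T → headsIn G (reverse (result r) e) T + bit (T y) ≡ headsIn G o T + bit (T u)
      heads′ T = begin
        headsIn G (reverse (result r) e) T + bit (T y)
          ≡⟨ cong (λ z → headsIn G (reverse (result r) e) T + bit (T z)) (head-cong G {result r} {o} unchanged) ⟨
        headsIn G (reverse (result r) e) T + bit (T (head G (result r) e))
          ≡⟨ headsIn-reverse G (result r) e T ⟩
        headsIn G (result r) T + bit (T (tail G (result r) e))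
          ≡⟨ cong (λ z → headsIn G (result r) T + bit (T z)) (tail-cong G {result r} {o} unchanged) ⟩
        headsIn G (result r) T + bit (T x)
          ≡⟨ heads r T ⟩
        headsIn G o T + bit (T u) ∎
        where open ≡-Reasoning

  -- An edge can be given either direction within the class of a strong
  -- orientation, by reversing a directed cycle through it.
  direct : ∀ {o} → Strong G o → ∀ e → ∃[ o′ ] SameHeads G o o′ × lookup o′ e ≡ true
  direct {o} strong e with lookup o e in eq
  ... | true  = o , (λ S → refl) , eq
  ... | false with reroute {o} strong (src G e) (tgt G e)
  ...   | S , r = reverse result e , same , trans (lookup∘updateAt e result) (cong not unchanged)
    where
    open Rerouted r
    unchanged : lookup result e ≡ false
    unchanged = trans (from-end e (cong (λ b → if b then src G e else tgt G e) eq)) eq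
    same : SameHeads G o (reverse result e)
    same T = ℕ.+-cancelʳ-≡ (bit (T (src G e))) _ _ (begin
      headsIn G o T + bit (T (src G e))
        ≡⟨ heads T ⟨
      headsIn G result T + bit (T (tgt G e))
        ≡⟨ cong (λ b → headsIn G result T + bit (T (if b then src G e else tgt G e))) unchanged ⟨
      headsIn G result T + bit (T (tail G result e))
        ≡⟨ headsIn-reverse G result e T ⟨
      headsIn G (reverse result e) T + bit (T (head G result e))
        ≡⟨ cong (λ b → headsIn G (reverse result e) T + bit (T (if b then tgt G e else src G e))) unchanged ⟩
      headsIn G (reverse result e) T + bit (T (src G e)) ∎)
      where open ≡-Reasoning

-- Classes of strong orientations

strongClasses : Graph n m → Setoid 0ℓ 0ℓ
strongClasses {m = m} G = record
  { Carrier       = Σ[ o ∈ Orientation m ] Strong G o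
  ; _≈_           = λ (o₁ , _) (o₂ , _) → SameHeads G o₁ o₂
  ; isEquivalence = record
    { refl  = λ S → refl
    ; sym   = λ p S → sym (p S)
    ; trans = λ p q S → trans (p S) (q S)
    }
  }

entering⇒crosses : ∀ (G : Graph n m) o S e → S (head G o e) ≡ true → S (tail G o e) ≡ false →
                   crosses G S e ≡ true
entering⇒crosses G o S e h∈S t∉S with lookup o e
... | true  = ≢⇒xor _ _ (true≢false h∈S t∉S ∘ sym)
... | false = ≢⇒xor _ _ (true≢false h∈S t∉S)

crosses⇒entering : ∀ (G : Graph n m) o S e → crosses G S e ≡ true →
  (S (head G o e) ≡ true × S (tail G o e) ≡ false) ⊎ (S (head G o e) ≡ false × S (tail G o e) ≡ true)
crosses⇒entering G o S e e× with lookup o e | S (src G e) in s | S (tgt G e) in t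
... | true  | true  | false = inj₂ (t , s)
... | true  | false | true  = inj₁ (t , s)
... | false | true  | false = inj₁ (s , t)
... | false | false | true  = inj₂ (s , t)

-- Being alone in its cut, the bridge would have to both enter and leave `S`.
bridge⇒¬strong : ∀ (G : Graph n m) {e} → IsBridge G e → ∀ o → ¬ Strong G o
bridge⇒¬strong G {e} isBridge o strong with bridge⇒onlyCrossing G isBridge
... | S , e× , only with crosses-true G S e e×
... | u , v , _ , u∈S , v∉S with strong S u∈S v∉S | strong (not ∘ S) (cong not v∉S) (cong not u∈S)
... | f , h∈S , t∉S | g , h∉S , t∈S with only f refl (entering⇒crosses G o S f h∈S t∉S)
    | only g refl (trans (sym (xor-not (S (src G g)) (S (tgt G g))))
                         (entering⇒crosses G o (not ∘ S) g h∉S t∈S))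
... | refl | refl = true≢false h∈S (Bool.not-injective h∉S) refl

-- Orientations that extend an orientation of G minus e

module Insertion (G : Graph n (suc m)) (e : Fin (suc m)) where

  ahead behind : Bool → Fin n
  ahead  b = if b then tgt G e else src G e
  behind b = if b then src G e else tgt G e

  module _ (o : Orientation m) (b : Bool) where

    head-insert : ∀ f → head G (insertAt o e b) (punchIn e f) ≡ head (delete G e) o f
    head-insert f = cong (λ b → if b then tgt G (punchIn e f) else src G (punchIn e f)) (insertAt-punchIn o e b f)

    tail-insert : ∀ f → tail G (insertAt o e b) (punchIn e f) ≡ tail (delete G e) o f
    tail-insert f = cong (λ b → if b then src G (punchIn e f) else tgt G (punchIn e f)) (insertAt-punchIn o e b f)

    headsIn-insert : ∀ S → headsIn G (insertAt o e b) S ≡ bit (S (ahead b)) + headsIn (delete G e) o S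
    headsIn-insert S = trans (sum-remove {i = e} (λ f → bit (S (head G (insertAt o e b) f))))
      (cong₂ _+_ (cong (bit ∘ S ∘ ahead) (insertAt-lookup o e b))
                 (sum-cong-≗ λ f → cong (bit ∘ S) (head-insert f)))

    strong-insert : Strong (delete G e) o → Strong G (insertAt o e b)
    strong-insert strong S u∈S v∉S =
      let f , h∈S , t∉S = strong S u∈S v∉S
      in  punchIn e f , trans (cong S (head-insert f)) h∈S , trans (cong S (tail-insert f)) t∉S

    enters : Strong G (insertAt o e b) → ∀ S {u v} → S u ≡ true → S v ≡ false →
             (S (ahead b) ≡ true × S (behind b) ≡ false) ⊎
             (∃[ f ] S (head (delete G e) o f) ≡ true × S (tail (delete G e) o f) ≡ false)
    enters strong S u∈S v∉S with strong S u∈S v∉S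
    ... | f , h∈S , t∉S with aroundView e f
    ... | here    = inj₁ (trans (sym (cong (S ∘ ahead) (insertAt-lookup o e b))) h∈S ,
                          trans (sym (cong (S ∘ behind) (insertAt-lookup o e b))) t∉S)
    ... | there f = inj₂ (f , trans (sym (cong S (head-insert f))) h∈S ,
                              trans (sym (cong S (tail-insert f))) t∉S)

  sameHeads-insert⁺ : ∀ {o₁ o₂} b → SameHeads (delete G e) o₁ o₂ →
                      SameHeads G (insertAt o₁ e b) (insertAt o₂ e b)
  sameHeads-insert⁺ {o₁} {o₂} b same S = trans (headsIn-insert o₁ b S)
    (trans (cong (bit (S (ahead b)) +_) (same S)) (sym (headsIn-insert o₂ b S)))

  sameHeads-insert⁻ : ∀ {o₁ o₂} b → SameHeads G (insertAt o₁ e b) (insertAt o₂ e b) →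
                      SameHeads (delete G e) o₁ o₂
  sameHeads-insert⁻ {o₁} {o₂} b same S = ℕ.+-cancelˡ-≡ (bit (S (ahead b))) _ _
    (trans (sym (headsIn-insert o₁ b S)) (trans (same S) (headsIn-insert o₂ b S)))

  -- A loop enters no set, and both of its directions put a head at the same vertex. So fixing the
  -- direction `true` misses no class.
  strongClasses-loop : IsLoop G e → Bijection (strongClasses (delete G e)) (strongClasses G)
  strongClasses-loop isLoop = bijection
    (λ (o , strong) → insertAt o e true , strong-insert o true strong)
    (sameHeads-insert⁺ true) (sameHeads-insert⁻ true) cover
    where
    ahead≡behind : ∀ b → ahead b ≡ behind b
    ahead≡behind true  = sym isLoop
    ahead≡behind false = isLoop
    ahead≡tgt : ∀ b → ahead b ≡ tgt G e
    ahead≡tgt true  = refl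
    ahead≡tgt false = isLoop
    cover : ∀ ((o , _) : Setoid.Carrier (strongClasses G)) →
            ∃[ o′ ] SameHeads G (insertAt (proj₁ o′) e true) o
    cover (o , strong) = (removeAt o e , strong′) , same
      where
      b : Bool
      b = lookup o e
      strong′ : Strong (delete G e) (removeAt o e)
      strong′ S u∈S v∉S
        with enters (removeAt o e) b (subst (Strong G) (sym (insertAt-removeAt o e)) strong) S u∈S v∉S
      ... | inj₁ (h∈S , t∉S) = contradiction (cong S (ahead≡behind b)) (true≢false h∈S t∉S)
      ... | inj₂ found       = found
      same : SameHeads G (insertAt (removeAt o e) e true) o
      same S = begin
        headsIn G (insertAt (removeAt o e) e true) S
          ≡⟨ headsIn-insert (removeAt o e) true S ⟩
        bit (S (tgt G e)) + headsIn (delete G e) (removeAt o e) S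
          ≡⟨ cong (λ v → bit (S v) + headsIn (delete G e) (removeAt o e) S) (ahead≡tgt b) ⟨
        bit (S (ahead b)) + headsIn (delete G e) (removeAt o e) S
          ≡⟨ headsIn-insert (removeAt o e) b S ⟨
        headsIn G (insertAt (removeAt o e) e b) S
          ≡⟨ cong (λ o → headsIn G o S) (insertAt-removeAt o e) ⟩
        headsIn G o S ∎
        where open ≡-Reasoning

  direct-insert : ∀ {o} → Strong G o → ∃[ o′ ] SameHeads G o (insertAt o′ e true)
  direct-insert {o} strong =
    let o′ , same , o′e = direct G {o} strong e
    in  removeAt o′ e , λ S → trans (same S) (cong (λ o → headsIn G o S)
          (trans (sym (insertAt-removeAt o′ e)) (cong (insertAt (removeAt o′ e) e) o′e)))

-- Strong classes under deletion and contraction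

module _ (G : Graph (suc n) (suc m)) (e : Fin (suc m)) (¬loop : ¬ IsLoop G e)
  (conn : CutConnected (delete G e) (λ _ → true)) where

  open Insertion G e
  open Contraction G e ¬loop

  private
    s t : Fin (suc n)
    s = src G e
    t = tgt G e
    D : Graph (suc n) m
    D = delete G e
    C : Graph n m
    C = contract G e ¬loop

  head-contract : ∀ o f → head C o f ≡ identify (head D o f)
  head-contract o f with lookup o f
  ... | true  = refl
  ... | false = refl

  tail-contract : ∀ o f → tail C o f ≡ identify (tail D o f)
  tail-contract o f with lookup o f
  ... | true  = refl
  ... | false = refl

  headsIn-pull : ∀ o S → headsIn C o S ≡ headsIn D o (S ∘ identify)
  headsIn-pull o S = sum-cong-≗ λ f → cong (bit ∘ S) (head-contract o f)

  headsIn-push : ∀ o S → S s ≡ S t → headsIn D o S ≡ headsIn C o (S ∘ section)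
  headsIn-push o S s≡t = trans
    (sum-cong-≗ λ f → cong bit (sym (section-identify S s≡t (head D o f))))
    (sym (headsIn-pull o (S ∘ section)))

  -- Equivalence in the contraction, read off in `D`: it forgets how heads are divided between `s`
  -- and `t`.
  SameAway : Orientation m → Orientation m → Set
  SameAway o₁ o₂ = ∀ S → S s ≡ S t → headsIn D o₁ S ≡ headsIn D o₂ S

  sameAway⇒sameHeads : ∀ {o₁ o₂} → SameAway o₁ o₂ → SameHeads C o₁ o₂
  sameAway⇒sameHeads {o₁} {o₂} same S = trans (headsIn-pull o₁ S)
    (trans (same (S ∘ identify) (cong S identify-ends)) (sym (headsIn-pull o₂ S)))

  sameHeads⇒sameAway : ∀ {o₁ o₂} → SameHeads C o₁ o₂ → SameAway o₁ o₂
  sameHeads⇒sameAway {o₁} {o₂} same S s≡t = trans (headsIn-push o₁ S s≡t)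
    (trans (same (S ∘ section)) (sym (headsIn-push o₂ S s≡t)))

  strong-contract : ∀ {o} b → Strong G (insertAt o e b) → Strong C o
  strong-contract {o} b strong S {u} {v} u∈S v∉S
    with enters o b strong (S ∘ identify) (trans (cong S (identify-section u)) u∈S)
                                          (trans (cong S (identify-section v)) v∉S)
  ... | inj₁ (h∈S , t∉S)     = contradiction (ends b) (true≢false h∈S t∉S)
    where
    ends : ∀ b → S (identify (ahead b)) ≡ S (identify (behind b))
    ends true  = sym (cong S identify-ends)
    ends false = cong S identify-ends
  ... | inj₂ (f , h∈S , t∉S) = f , trans (cong S (head-contract o f)) h∈S ,
                                   trans (cong S (tail-contract o f)) t∉S

  Closed : Orientation m → (Fin (suc n) → Bool) → Set
  Closed o S = ∀ f → ¬ (S (head D o f) ≡ true × S (tail D o f) ≡ false)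

  contract-enters : ∀ {o} → Strong C o → ∀ S → S s ≡ S t → ∀ {u v} → S u ≡ true → S v ≡ false →
                    ¬ Closed o S
  contract-enters {o} strong S s≡t {u} {v} u∈S v∉S closed =
    let f , h∈S , t∉S = strong (S ∘ section) (trans (section-identify S s≡t u) u∈S)
                                             (trans (section-identify S s≡t v) v∉S)
    in  closed f (at f head head-contract h∈S , at f tail tail-contract t∉S)
    where
    at : ∀ f (end : ∀ {n} → Graph n m → Orientation m → Fin m → Fin n) →
         (∀ o f → end C o f ≡ identify (end D o f)) →
         ∀ {b} → S (section (end C o f)) ≡ b → S (end D o f) ≡ b
    at f end end-contract eq = trans (sym (trans (cong (S ∘ section) (end-contract o f))
                                                 (section-identify S s≡t (end D o f)))) eq

  -- A trap for each direction of e would give disjoint complementary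
  -- sets S ∋ s and T ∋ t joined by no edge except e.
  no-opposite-traps : ∀ {o S T} → Strong C o → S s ≡ true → S t ≡ false → T s ≡ false → T t ≡ true →
                      Closed o S → ¬ Closed o T
  no-opposite-traps {o} {S} {T} strong s∈S t∉S s∉T t∈T closedS closedT
    with conn S s∈S t∉S
  ... | f , _ , f× =
    -- Since `e` is not a bridge, some other edge `f` joins the two sides; it enters one of them.
    [ closedS f , (λ (h∉S , t∈S) → closedT f (complement-true h∉S , complement-false t∈S)) ]′
      (crosses⇒entering D o S f f×)
    where
    -- Closed sets are preserved by intersection and union. Neither of these two separates `s` from
    -- `t`, so strongness of the contraction forces the intersection to be empty and the union to be
    -- everything.
    meet join : Fin (suc n) → Bool
    meet v = S v ∧ T v
    join v = S v ∨ T v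
    disjoint : ∀ x → meet x ≡ false
    disjoint x = Bool.¬-not λ x∈ → contract-enters {o} strong meet
      (trans (cong₂ _∧_ s∈S s∉T) (sym (cong₂ _∧_ t∉S t∈T))) x∈ (cong₂ _∧_ s∈S s∉T) closed
      where
      closed : Closed o meet
      closed f (h∈ , t∉) with S (head D o f) in hS | T (head D o f) in hT | S (tail D o f) in tS
                             | T (tail D o f) in tT
      ... | true | true | false | _     = closedS f (hS , tS)
      ... | true | true | true  | false = closedT f (hT , tT)
    covering : ∀ x → join x ≡ true
    covering x = Bool.¬-not λ x∉ → contract-enters {o} strong join
      (trans (cong₂ _∨_ s∈S s∉T) (sym (cong₂ _∨_ t∉S t∈T))) (cong₂ _∨_ s∈S s∉T) x∉ closed
      where
      closed : Closed o join
      closed f (h∈ , t∉) with S (head D o f) in hS | T (head D o f) in hT | S (tail D o f) in tS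
                             | T (tail D o f) in tT
      ... | true  | _    | false | _     = closedS f (hS , tS)
      ... | false | true | false | false = closedT f (hT , tT)
    complement-true : ∀ {x} → S x ≡ false → T x ≡ true
    complement-true {x} x∉S = trans (cong (_∨ T x) (sym x∉S)) (covering x)
    complement-false : ∀ {x} → S x ≡ true → T x ≡ false
    complement-false {x} x∈S = trans (cong (_∧ T x) (sym x∈S)) (disjoint x)

  -- A trap for a given direction of `e` must be left by `e`: otherwise it would not separate `s`
  -- from `t` and would be a trap of the contraction, or `e` would enter it. If both directions
  -- fail, the two traps are thus opposite.
  lift : ∀ {o} → Strong C o → ∃[ b ] Strong G (insertAt o e b)
  lift {o} strong with strong⊎trap G (insertAt o e true) | strong⊎trap G (insertAt o e false)
  ... | inj₁ st | _       = true , st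
  ... | inj₂ _  | inj₁ st = false , st
  ... | inj₂ (S , trapS) | inj₂ (T , trapT) =
    let s∈S , t∉S = separated true  S trapS
        t∈T , s∉T = separated false T trapT
    in  contradiction (closed false T trapT)
          (no-opposite-traps {o} {S} {T} strong s∈S t∉S s∉T t∈T (closed true S trapS))
    where
    closed : ∀ b S → Trap G (insertAt o e b) S → Closed o S
    closed b S (_ , _ , closed) f (h∈S , t∉S) = closed (punchIn e f)
      (trans (cong S (head-insert o b f)) h∈S , trans (cong S (tail-insert o b f)) t∉S)
    ends : ∀ b S {c} → S (behind b) ≡ c → S (ahead b) ≡ c → S s ≡ S t
    ends true  S p q = trans p (sym q)
    ends false S p q = trans q (sym p)
    separated : ∀ b S → Trap G (insertAt o e b) S → S (behind b) ≡ true × S (ahead b) ≡ false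
    separated b S trap@((u , u∈S) , (v , v∉S) , closed′) with S (behind b) in p | S (ahead b) in q
    ... | true  | false = refl , refl
    ... | false | true  = contradiction
      (trans (cong (S ∘ ahead) (insertAt-lookup o e b)) q , trans (cong (S ∘ behind) (insertAt-lookup o e b)) p)
      (closed′ e)
    ... | true  | true  = contradiction (closed b S trap) (contract-enters {o} strong S (ends b S p q) u∈S v∉S)
    ... | false | false = contradiction (closed b S trap) (contract-enters {o} strong S (ends b S p q) u∈S v∉S)

  -- The classes of G are those obtained from G minus e by directing e
  -- from s to t, and the critical ones, one for each class of the
  -- contraction: among the classes with the same contraction it is the
  -- one with the fewest heads at t.
  Critical : Orientation m → Set
  Critical o = Strong G (insertAt o e true) × ¬ Strong D o

  private
    at-t : Fin (suc n) → Bool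
    at-t v = does (v ≟ t)

    without-t : (Fin (suc n) → Bool) → Fin (suc n) → Bool
    without-t S v = S v ∧ not (at-t v)

  headsIn-without : ∀ o S → S t ≡ true → headsIn D o S ≡ headsIn D o (without-t S) + headsIn D o at-t
  headsIn-without o S t∈S = #-split λ f → pointwise (head D o f)
    where
    pointwise : ∀ v → bit (S v) ≡ bit (without-t S v) + bit (at-t v)
    pointwise v with v ≟ t
    ... | yes refl rewrite t∈S = refl
    ... | no _ = trans (cong bit (sym (Bool.∧-identityʳ (S v)))) (sym (ℕ.+-identityʳ _))

  without-t-away : ∀ S → S s ≡ false → without-t S s ≡ without-t S t
  without-t-away S s∉S = trans (cong (_∧ not (at-t s)) s∉S)
    (sym (trans (cong (λ b → S t ∧ not b) (dec-true (t ≟ t) refl)) (Bool.∧-zeroʳ (S t))))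

  headsIn-complement : ∀ o S → headsIn D o S + headsIn D o (not ∘ S) ≡ headsIn D o (λ _ → true)
  headsIn-complement o S = sym (#-split λ f → pointwise (S (head D o f)))
    where
    pointwise : ∀ b → 1 ≡ bit b + bit (not b)
    pointwise true  = refl
    pointwise false = refl

  sameAway-containing-t : ∀ {o₁ o₂} → SameAway o₁ o₂ → headsIn D o₁ at-t ≡ headsIn D o₂ at-t →
                          ∀ S → S s ≡ false → S t ≡ true → headsIn D o₁ S ≡ headsIn D o₂ S
  sameAway-containing-t {o₁} {o₂} same same-t S s∉S t∈S = trans (headsIn-without o₁ S t∈S)
    (trans (cong₂ _+_ (same (without-t S) (without-t-away S s∉S)) same-t)
           (sym (headsIn-without o₂ S t∈S)))

  -- The number of heads at `t` is a coordinate on the chain. Removing `t` from a set that contains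
  -- `t` but not `s` leaves one that does not separate them; a set containing only `s` is the
  -- complement of such a set, and the total is fixed.
  sameAway-determined : ∀ {o₁ o₂} → SameAway o₁ o₂ → headsIn D o₁ at-t ≡ headsIn D o₂ at-t →
                        SameHeads D o₁ o₂
  sameAway-determined {o₁} {o₂} same same-t S with S s in s∈ | S t in t∈
  ... | true  | true  = same S (trans s∈ (sym t∈))
  ... | false | false = same S (trans s∈ (sym t∈))
  ... | false | true  = sameAway-containing-t {o₁} {o₂} same same-t S s∈ t∈
  ... | true  | false = ℕ.+-cancelʳ-≡ (headsIn D o₁ (not ∘ S)) _ _ (begin
    headsIn D o₁ S + headsIn D o₁ (not ∘ S)  ≡⟨ headsIn-complement o₁ S ⟩
    headsIn D o₁ (λ _ → true)                ≡⟨ same (λ _ → true) refl ⟩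
    headsIn D o₂ (λ _ → true)                ≡⟨ headsIn-complement o₂ S ⟨
    headsIn D o₂ S + headsIn D o₂ (not ∘ S)
      ≡⟨ cong (headsIn D o₂ S +_)
              (sameAway-containing-t {o₁} {o₂} same same-t (not ∘ S) (cong not s∈) (cong not t∈)) ⟨
    headsIn D o₂ S + headsIn D o₁ (not ∘ S)  ∎)
    where open ≡-Reasoning

  -- The edge `e` is of use only to sets `S` with `t` inside and `s` outside. In each of these `o₂`
  -- has more heads than `o₁`, hence more entering edges of `D`, hence at least one.
  more-heads⇒strong : ∀ {o₁ o₂} → Strong G (insertAt o₁ e true) → Strong G (insertAt o₂ e true) →
                      SameAway o₁ o₂ → headsIn D o₁ at-t < headsIn D o₂ at-t → Strong D o₂
  more-heads⇒strong {o₁} {o₂} strong₁ strong₂ same fewer S u∈S v∉S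
    with enters o₂ true strong₂ S u∈S v∉S
  ... | inj₂ found       = found
  ... | inj₁ (t∈S , s∉S) = positive⇒entering D o₂ S
    (ℕ.≤-<-trans z≤n (ℕ.+-cancelʳ-< _ _ _ (subst₂ _<_ (headsIn-split D o₁ S) (headsIn-split D o₂ S) more)))
    where
    more : headsIn D o₁ S < headsIn D o₂ S
    more = subst₂ _<_ (sym (headsIn-without o₁ S t∈S)) (sym (headsIn-without o₂ S t∈S))
      (ℕ.+-mono-≤-< (ℕ.≤-reflexive (same (without-t S) (without-t-away S s∉S))) fewer)

  critical-unique : ∀ {o₁ o₂} → Critical o₁ → Critical o₂ → SameAway o₁ o₂ → SameHeads D o₁ o₂
  critical-unique {o₁} {o₂} (strong₁ , ¬strong₁) (strong₂ , ¬strong₂) same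
    with ℕ.<-cmp (headsIn D o₁ at-t) (headsIn D o₂ at-t)
  ... | tri< fewer _ _ = contradiction (more-heads⇒strong {o₁} {o₂} strong₁ strong₂ same fewer) ¬strong₂
  ... | tri≈ _ eq _    = sameAway-determined {o₁} {o₂} same eq
  ... | tri> _ _ more  = contradiction
    (more-heads⇒strong {o₂} {o₁} strong₂ strong₁ (λ S s≡t → sym (same S s≡t)) more) ¬strong₁

  sameAway-insert : ∀ {o₁ o₂} b₁ b₂ → SameHeads G (insertAt o₁ e b₁) (insertAt o₂ e b₂) → SameAway o₁ o₂
  sameAway-insert {o₁} {o₂} b₁ b₂ same S s≡t = ℕ.+-cancelˡ-≡ (bit (S t)) _ _
    (trans (sym (at o₁ b₁)) (trans (same S) (at o₂ b₂)))
    where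
    at : ∀ o b → headsIn G (insertAt o e b) S ≡ bit (S t) + headsIn D o S
    at o true  = headsIn-insert o true S
    at o false = trans (headsIn-insert o false S) (cong (λ b → bit b + headsIn D o S) s≡t)

  -- Descent on the number of heads at `t`, bounded by `k`. If `o` is strong without `e`, then `e`
  -- may be directed from `t` to `s`; a representative of that class with `e` turned back has one
  -- head fewer at `t` among the remaining edges.
  critical-below : ∀ k {o} → headsIn D o at-t < k → Strong G (insertAt o e true) →
                   ∃[ o′ ] Critical o′ × SameAway o′ o
  critical-below (suc k) {o} (s≤s ≤k) strong with strong⊎trap D o
  ... | inj₂ (S , trap) = o , (strong , trap⇒¬strong D {o} {S} trap) , λ S _ → refl
  ... | inj₁ strongD with direct-insert {insertAt o e false} (strong-insert o false strongD)
  ...   | o′ , same =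
    let o″ , critical , away = critical-below k {o′} (ℕ.<-≤-trans (ℕ.≤-reflexive decrease) ≤k)
                                 (strong-resp G {insertAt o e false} {insertAt o′ e true} same (strong-insert o false strongD))
    in  o″ , critical , λ S s≡t → trans (away S s≡t) (sym (sameAway-insert {o} {o′} false true same S s≡t))
    where
    decrease : suc (headsIn D o′ at-t) ≡ headsIn D o at-t
    decrease = begin
      suc (headsIn D o′ at-t)
        ≡⟨ cong (λ b → bit b + headsIn D o′ at-t) (dec-true (t ≟ t) refl) ⟨
      bit (at-t t) + headsIn D o′ at-t
        ≡⟨ headsIn-insert o′ true at-t ⟨
      headsIn G (insertAt o′ e true) at-t
        ≡⟨ same at-t ⟨
      headsIn G (insertAt o e false) at-t
        ≡⟨ headsIn-insert o false at-t ⟩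
      bit (at-t s) + headsIn D o at-t
        ≡⟨ cong (λ b → bit b + headsIn D o at-t) (dec-false (s ≟ t) ¬loop) ⟩
      headsIn D o at-t ∎
      where open ≡-Reasoning

  abstract
    critical-exists : ∀ {o} → Strong C o → ∃[ o′ ] Critical o′ × SameHeads C o′ o
    critical-exists {o} strong with lift {o} strong
    ... | b , strongG with direct-insert {insertAt o e b} strongG
    ... | o′ , same =
      let o″ , critical , away = critical-below _ {o′} ℕ.≤-refl
                                 (strong-resp G {insertAt o e b} {insertAt o′ e true} same strongG)
      in  o″ , critical , sameAway⇒sameHeads {o″} {o} λ S s≡t →
            trans (away S s≡t) (sym (sameAway-insert {o} {o′} b true same S s≡t))

  strongClasses-ordinary : Bijection (strongClasses D ⊎ₛ strongClasses C) (strongClasses G)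
  strongClasses-ordinary = bijection-⊎ from-D from-C
    (λ {x} {y} → sameHeads-insert⁺ {proj₁ x} {proj₁ y} true)
    (λ {x} {y} → sameHeads-insert⁻ {proj₁ x} {proj₁ y} true)
    (λ {x} {y} → cong-C {x} {y}) (λ {x} {y} → injective-C {x} {y}) disjoint cover
    where
    from-D : Setoid.Carrier (strongClasses D) → Setoid.Carrier (strongClasses G)
    from-D (o , strong) = insertAt o e true , strong-insert o true strong

    critical : Setoid.Carrier (strongClasses C) → Orientation m
    critical (o , strong) = proj₁ (critical-exists {o} strong)

    is-critical : ∀ c → Critical (critical c)
    is-critical (o , strong) = proj₁ (proj₂ (critical-exists {o} strong))

    critical-contracts : ∀ c → SameHeads C (critical c) (proj₁ c)
    critical-contracts (o , strong) = proj₂ (proj₂ (critical-exists {o} strong))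

    from-C : Setoid.Carrier (strongClasses C) → Setoid.Carrier (strongClasses G)
    from-C c = insertAt (critical c) e true , proj₁ (is-critical c)

    -- The critical orientation is chosen from a representative; its uniqueness makes the choice
    -- well defined on classes.
    cong-C : ∀ {c d} → SameHeads C (proj₁ c) (proj₁ d) →
             SameHeads G (insertAt (critical c) e true) (insertAt (critical d) e true)
    cong-C {c} {d} same = sameHeads-insert⁺ {critical c} {critical d} true
      (critical-unique {critical c} {critical d} (is-critical c) (is-critical d)
        (sameHeads⇒sameAway {critical c} {critical d} λ S →
        trans (critical-contracts c S) (trans (same S) (sym (critical-contracts d S)))))

    injective-C : ∀ {c d} → SameHeads G (insertAt (critical c) e true) (insertAt (critical d) e true) →
                  SameHeads C (proj₁ c) (proj₁ d)
    injective-C {c} {d} same S = trans (sym (critical-contracts c S))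
      (trans (sameAway⇒sameHeads {critical c} {critical d} (sameAway-insert {critical c} {critical d} true true same) S)
             (critical-contracts d S))

    disjoint : ∀ x c → ¬ SameHeads G (insertAt (proj₁ x) e true) (insertAt (critical c) e true)
    -- Strongness without `e` is an invariant of the class, and critical orientations lack it.
    disjoint (o , strong) c same = proj₂ (is-critical c)
      (strong-resp D {o} {critical c} (sameHeads-insert⁻ {o} {critical c} true same) strong)

    cover : ∀ ((o , _) : Setoid.Carrier (strongClasses G)) →
            (∃[ x ] SameHeads G (proj₁ (from-D x)) o) ⊎ (∃[ c ] SameHeads G (proj₁ (from-C c)) o)
    cover (o , strong) with direct-insert {o} strong
    ... | o′ , same with strong⊎trap D o′
    ... | inj₁ strongD    = inj₁ ((o′ , strongD) , λ S → sym (same S))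
    -- Here `o′` is itself critical, so it agrees with the critical orientation chosen over its own
    -- contraction.
    ... | inj₂ (T , trap) = inj₂ (c , λ S → trans
      (sameHeads-insert⁺ {critical c} {o′} true (critical-unique {critical c} {o′}
        (is-critical c) (strong′ , trap⇒¬strong D {o′} {T} trap)
        (sameHeads⇒sameAway {critical c} {o′} (critical-contracts c))) S)
      (sym (same S)))
      where
      strong′ : Strong G (insertAt o′ e true)
      strong′ = strong-resp G {o} {insertAt o′ e true} same strong
      c : Setoid.Carrier (strongClasses C)
      c = o′ , strong-contract {o′} true strong′

-- Counting strong classes

strongClasses-edgeless : ∀ (G : Graph n 0) → CutConnected G (λ _ → true) → HasCardinality (strongClasses G) 1
strongClasses-edgeless G conn = record
  { to        = λ _ → zero
  ; from      = λ _ → [] , λ S u∈S v∉S → case conn S u∈S v∉S of λ ()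
  ; to-cong   = λ _ → refl
  ; from-cong = λ _ _ → refl
  ; inverse   = (λ { {zero} _ → refl }) , λ { {[] , _} _ _ → refl }
  }

-- The induction follows an arbitrary derivation; this generality is what makes different
-- derivations agree at (0,1).
tutte-strongClasses : ∀ {G : Graph n m} {T} → CutConnected G (λ _ → true) → IsTutte G T →
                      HasCardinality (strongClasses G) (eval T 0 1)
tutte-strongClasses conn edgeless = strongClasses-edgeless _ conn
tutte-strongClasses {G = G} conn (bridge e ¬loop isBridge _) =
  card-empty λ (o , strong) → bridge⇒¬strong G isBridge o strong
tutte-strongClasses {G = G} conn (loop {T = T} e isLoop isT) =
  evaluates (y· T) (card-bijection (Insertion.strongClasses-loop G e isLoop)
    (tutte-strongClasses (cutConnected-loop {G = G} conn isLoop) isT)) (eval-y T)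
tutte-strongClasses {G = G} conn (ordinary {T = T} {T′} e ¬loop ¬bridge isT isT′) =
  evaluates (T ⊞ T′) (card-bijection (strongClasses-ordinary G e ¬loop conn′)
    (card-⊎ (tutte-strongClasses conn′ isT)
            (tutte-strongClasses (Contraction.cutConnected-contract G e ¬loop conn) isT′)))
    (eval-⊞ T T′)
  where conn′ = cutConnected-nonbridge {G = G} conn ¬bridge

-- Strong orientations are those without directed cuts

∈-tabulate⁺ : ∀ (p : Fin m → Bool) {e} → p e ≡ true → e ∈ tabulate p
∈-tabulate⁺ p {e} pe = lookup⇒∈ (trans (lookup∘tabulate p e) pe)

∈-tabulate⁻ : ∀ (p : Fin m → Bool) {e} → e ∈ tabulate p → p e ≡ true
∈-tabulate⁻ p {e} e∈ = trans (sym (lookup∘tabulate p e)) (∈⇒lookup e∈)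

lookup-∁ : ∀ (p : Subset n) {x b} → lookup p x ≡ b → lookup (∁ p) x ≡ not b
lookup-∁ p {x} eq = trans (lookup-map x not p) (cong not eq)

-- A union of no bonds is empty, so a nonempty directed cut comes with at least one directed bond.
-- The first of them already leaves a side that no edge enters.
strong⇒BO : ∀ (G : Graph n m) {o} → Strong G o → BO G o
strong⇒BO G {o} strong (_ , (e , e∈C) , _ , []     , _ , _ , refl) = ∉⊥ e∈C
strong⇒BO G {o} strong (_ , _ , _ , B ∷ _ , (_ , p , ((u , u∈p) , (v , v∈∁p)) , _ , inj₁ empty) ∷ _ , _) =
  let e , h∉p , t∈p = strong (not ∘ lookup p)
                            (trans (sym (lookup-map v not p)) (∈⇒lookup v∈∁p)) (cong not (∈⇒lookup u∈p))
  in  empty (e , ∈-tabulate⁺ (λ e → lookup p (tail G o e) ∧ not (lookup p (head G o e)))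
                   (cong₂ _∧_ (Bool.not-injective t∈p) h∉p))
strong⇒BO G {o} strong (_ , _ , _ , B ∷ _ , (_ , p , ((u , u∈p) , (v , v∈∁p)) , _ , inj₂ empty) ∷ _ , _) =
  let e , h∈p , t∉p = strong (lookup p) (∈⇒lookup u∈p)
                            (Bool.not-injective (trans (sym (lookup-map v not p)) (∈⇒lookup v∈∁p)))
  in  empty (e , ∈-tabulate⁺ (λ e → lookup (∁ p) (tail G o e) ∧ not (lookup (∁ p) (head G o e)))
                   (cong₂ (λ a b → a ∧ not b) (lookup-∁ p t∉p) (lookup-∁ p h∈p)))

-- Finding a bond inside the cut of a trap

_within_ : (Fin n → Bool) → (Fin n → Bool) → Graph n m → Set
(T within S) G = ∀ e → crosses G T e ≡ true → crosses G S e ≡ true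

module _ (G : Graph n m) (o : Orientation m) (conn : CutConnected G (λ _ → true)) where

  private
    cutOf : (Fin n → Bool) → Subset m
    cutOf S = tabulate (crosses G S)

    Inhabited : (Fin n → Bool) → Set
    Inhabited S = ∃[ x ] S x ≡ true

    inhabited? : ∀ S → Dec (Inhabited S)
    inhabited? S = any? λ x → S x Bool.≟ true

  module _ {S T : Fin n → Bool} (trap : Trap G o S) (T-within-S : (T within S) G) where

    private
      closed : ∀ e → ¬ (S (head G o e) ≡ true × S (tail G o e) ≡ false)
      closed = proj₂ (proj₂ trap)

      meet rest join extra : Fin n → Bool
      meet  v = S v ∧ T v
      rest  v = S v ∧ not (T v)
      join  v = S v ∨ T v
      extra v = not (S v) ∧ T v

      meet-within : (meet within S) G
      meet-within e e× with S (src G e) | S (tgt G e) | T-within-S e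
      ... | true  | false | _ = refl
      ... | false | true  | _ = refl
      ... | true  | true  | h = h e×

      rest-within : (rest within S) G
      rest-within e e× with S (src G e) | S (tgt G e) | T-within-S e
      ... | true  | false | _ = refl
      ... | false | true  | _ = refl
      ... | true  | true  | h = h (trans (sym (xor-not (T (src G e)) (T (tgt G e)))) e×)

      join-within : (join within S) G
      join-within e e× with S (src G e) | S (tgt G e) | T-within-S e
      ... | true  | false | _ = refl
      ... | false | true  | _ = refl
      ... | false | false | h = h e×

      extra-within : (extra within S) G
      extra-within e e× with S (src G e) | S (tgt G e) | T-within-S e
      ... | true  | false | _ = refl
      ... | false | true  | _ = refl
      ... | false | false | h = h e×

    -- No edge inside `S` crosses `T`, so an edge entering `meet` would enter `S`. The cut gets
    -- strictly smaller because connectedness gives an edge between `rest` and its complement; it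
    -- crosses `S` but misses `meet`.
    meet-trap : Inhabited meet → Inhabited rest → Trap G o meet × cutOf meet ⊂ cutOf S
    meet-trap (x , x∈) (y , y∈) =
      ((x , x∈) , (y , disjoint y y∈) , closed′) ,
      (λ {e} e∈ → ∈-tabulate⁺ (crosses G S) (meet-within e (∈-tabulate⁻ (crosses G meet) e∈))) ,
      (let f , _ , f× = conn rest y∈ (disjoint′ x x∈)
       in  f , ∈-tabulate⁺ (crosses G S) (rest-within f f×) ,
           λ f∈ → true≢false (∈-tabulate⁻ (crosses G meet) f∈) (not-both f f× (rest-within f f×)) refl)
      where
      disjoint : ∀ y → rest y ≡ true → meet y ≡ false
      disjoint y y∈ with S y | T y
      ... | true | false = refl
      disjoint′ : ∀ x → meet x ≡ true → rest x ≡ false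
      disjoint′ x x∈ with S x | T x
      ... | true | true = refl
      not-both : ∀ f → crosses G rest f ≡ true → crosses G S f ≡ true → crosses G meet f ≡ false
      not-both f r s with S (src G f) | S (tgt G f) | T (src G f) | T (tgt G f)
      ... | true  | false | false | _     = refl
      ... | false | true  | _     | false = refl
      closed′ : ∀ e → ¬ (meet (head G o e) ≡ true × meet (tail G o e) ≡ false)
      closed′ e (h∈ , t∉) with S (head G o e) in hS | S (tail G o e) in tS
      ... | true | false = closed e (hS , tS)
      ... | true | true  with crosses⇒entering G o S e (T-within-S e (entering⇒crosses G o T e h∈ t∉))
      ...   | inj₁ (_ , t∉S) = true≢false tS t∉S refl
      ...   | inj₂ (h∉S , _) = true≢false hS h∉S refl

    join-trap : Inhabited extra → Inhabited (not ∘ join) → Trap G o join × cutOf join ⊂ cutOf S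
    join-trap (x , x∈) (y , y∉) =
      ((x , covers x x∈) , (y , Bool.not-injective y∉) , closed′) ,
      (λ {e} e∈ → ∈-tabulate⁺ (crosses G S) (join-within e (∈-tabulate⁻ (crosses G join) e∈))) ,
      (let f , _ , f× = conn extra x∈ (avoids y (Bool.not-injective y∉))
       in  f , ∈-tabulate⁺ (crosses G S) (extra-within f f×) ,
           λ f∈ → true≢false (∈-tabulate⁻ (crosses G join) f∈) (not-both f f× (extra-within f f×)) refl)
      where
      covers : ∀ x → extra x ≡ true → join x ≡ true
      covers x x∈ with S x
      ... | false = x∈
      avoids : ∀ y → join y ≡ false → extra y ≡ false
      avoids y y∉ with S y
      ... | false = y∉
      not-both : ∀ f → crosses G extra f ≡ true → crosses G S f ≡ true → crosses G join f ≡ false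
      not-both f r s with S (src G f) | S (tgt G f) | T (src G f) | T (tgt G f)
      ... | true  | false | _    | true = refl
      ... | false | true  | true | _    = refl
      closed′ : ∀ e → ¬ (join (head G o e) ≡ true × join (tail G o e) ≡ false)
      closed′ e (h∈ , t∉) with S (head G o e) in hS | S (tail G o e) in tS
      ... | true  | false = closed e (hS , tS)
      ... | false | false with crosses⇒entering G o S e (T-within-S e (entering⇒crosses G o T e h∈ t∉))
      ...   | inj₁ (h∈S , _) = true≢false h∈S hS refl
      ...   | inj₂ (_ , t∈S) = true≢false t∈S tS refl

    -- `T` itself need not be a trap, as it may have parts on both sides of `S`; its intersection or
    -- union with `S` is used instead. If neither is available, one part in each of the two pairs is
    -- empty, and then `T` is empty, everything, `S` or the complement of `S`. The last two have the
    -- same cut as `S`, which `e` refutes.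
    smaller-trap : Inhabited T → Inhabited (not ∘ T) → ∀ {e} → crosses G S e ≡ true → crosses G T e ≡ false →
                   ∃[ U ] Trap G o U × cutOf U ⊂ cutOf S
    smaller-trap (x , x∈T) (y , y∉T) {e} e×S e×T
      with inhabited? meet | inhabited? rest | inhabited? extra | inhabited? (not ∘ join)
    ... | yes i | yes j | _     | _     = meet , meet-trap i j
    ... | _     | _     | yes i | yes j = join , join-trap i j
    ... | no ¬i | _     | no ¬j | _     = contradiction (both x x∈T) [ ¬i , ¬j ]′
      where
      both : ∀ x → T x ≡ true → Inhabited meet ⊎ Inhabited extra
      both x x∈T with S x in eq
      ... | true  = inj₁ (x , cong₂ _∧_ eq x∈T)
      ... | false = inj₂ (x , cong₂ (λ a b → not a ∧ b) eq x∈T)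
    ... | _     | no ¬i | _     | no ¬j = contradiction (both y (Bool.not-injective y∉T)) [ ¬i , ¬j ]′
      where
      both : ∀ y → T y ≡ false → Inhabited rest ⊎ Inhabited (not ∘ join)
      both y y∉T with S y in eq
      ... | true  = inj₁ (y , cong₂ (λ a b → a ∧ not b) eq y∉T)
      ... | false = inj₂ (y , cong₂ (λ a b → not (a ∨ b)) eq y∉T)
    ... | no ¬i | _     | _     | no ¬j = contradiction refl (true≢false
      (trans (cong₂ _xor_ (opposite _) (opposite _)) (trans (xor-not (S (src G e)) (S (tgt G e))) e×S)) e×T)
      where
      opposite : ∀ v → T v ≡ not (S v)
      opposite v with S v in s | T v in t
      ... | true  | false = refl
      ... | false | true  = refl
      ... | true  | true  = contradiction (v , cong₂ _∧_ s t) ¬i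
      ... | false | false = contradiction (v , cong₂ (λ a b → not (a ∨ b)) s t) ¬j
    ... | _     | no ¬i | no ¬j | _     = contradiction refl (true≢false
      (trans (cong₂ _xor_ (same _) (same _)) e×S) e×T)
      where
      same : ∀ v → T v ≡ S v
      same v with S v in s | T v in t
      ... | true  | true  = refl
      ... | false | false = refl
      ... | true  | false = contradiction (v , cong₂ (λ a b → a ∧ not b) s t) ¬i
      ... | false | true  = contradiction (v , cong₂ (λ a b → not a ∧ b) s t) ¬j

  -- A bond is minimal among all cuts, directed or not. The descent can nevertheless stay among
  -- traps, since any smaller cut yields a trap with a smaller cut.
  minimal-trap : ∀ S → Acc _⊂_ (cutOf S) → Trap G o S →
    ∃[ S′ ] Trap G o S′ × (∀ p → Proper G p → cut G p ⊆ cutOf S′ → cutOf S′ ⊆ cut G p)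
  minimal-trap S (acc rec) trap
    with anySubset? (λ p → (nonempty? p ×-dec nonempty? (∁ p)) ×-dec (cut G p ⊂? cutOf S))
  ... | yes (p , ((x , x∈p) , (y , y∈∁p)) , p⊆S , e , e∈S , e∉p) =
    let S′ , trap′ , smaller = smaller-trap {S} {lookup p} trap
          (λ f f× → ∈-tabulate⁻ (crosses G S) (p⊆S (∈-tabulate⁺ (crosses G (lookup p)) f×)))
          (x , ∈⇒lookup x∈p) (y , trans (sym (lookup-map y not p)) (∈⇒lookup y∈∁p))
          (∈-tabulate⁻ (crosses G S) e∈S) (Bool.¬-not (e∉p ∘ ∈-tabulate⁺ (crosses G (lookup p))))
    in  minimal-trap S′ (rec smaller) trap′
  ... | no minimal = S , trap , λ p proper p⊆S {e} e∈S → case e ∈? cut G p of λ where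
    (yes e∈p) → e∈p
    (no e∉p)  → contradiction (p , proper , (λ {f} → p⊆S {f}) , e , e∈S , e∉p) minimal

  trap⇒directedBond : ∀ {S} → Trap G o S → ∃[ B ] Nonempty B × IsDirectedBond G o B
  trap⇒directedBond {S₀} trap₀ with minimal-trap S₀ (⊂-wellFounded _) trap₀
  ... | S , ((u , u∈S) , (v , v∉S) , closed) , minimal =
    cut G p , nonempty , ((p , proper , refl) , nonempty , least) , p , proper , refl , inj₂ empty
    where
    p : Subset n
    p = tabulate S
    at : ∀ x → lookup p x ≡ S x
    at = lookup∘tabulate S
    proper : Proper G p
    proper = (u , ∈-tabulate⁺ S u∈S) , (v , lookup⇒∈ (lookup-∁ p (trans (at v) v∉S)))
    cut-p : cut G p ≡ cutOf S
    cut-p = tabulate-cong λ e → cong₂ _xor_ (at (src G e)) (at (tgt G e))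
    nonempty : Nonempty (cut G p)
    nonempty = let e , _ , e× = conn (lookup p) (trans (at u) u∈S) (trans (at v) v∉S)
               in  e , ∈-tabulate⁺ (crosses G (lookup p)) e×
    least : ∀ C → IsCut G C → Nonempty C → C ⊆ cut G p → C ≡ cut G p
    least _ (q , proper-q , refl) _ q⊆p = ⊆-antisym q⊆p
      (subst (_⊆ cut G q) (sym cut-p) (minimal q proper-q (subst (cut G q ⊆_) cut-p q⊆p)))
    empty : Empty (edgesOutOf G o (∁ p))
    empty (e , e∈) with lookup (∁ p) (tail G o e) in t | lookup (∁ p) (head G o e) in h
      | ∈-tabulate⁻ (λ e → lookup (∁ p) (tail G o e) ∧ not (lookup (∁ p) (head G o e))) e∈
    ... | true | false | _ = closed e (outside h , outside t)
      where
      outside : ∀ {x b} → lookup (∁ p) x ≡ b → S x ≡ not b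
      outside {x} {b} eq = trans (sym (Bool.not-involutive (S x))) (cong not
        (trans (sym (cong not (at x))) (trans (sym (lookup-map x not p)) eq)))

  BO⇒strong : BO G o → Strong G o
  BO⇒strong bo with strong⊎trap G o
  ... | inj₁ strong     = strong
  ... | inj₂ (S , trap) = contradiction (directedCut (trap⇒directedBond trap)) bo
    where
    directedCut : ∃[ B ] Nonempty B × IsDirectedBond G o B → ∃[ C ] Nonempty C × IsDirectedCut G o C
    directedCut (B , nonempty , bond@((isCut , _) , _)) =
      B , nonempty , isCut , B ∷ [] , bond ∷ [] , [] ∷ [] , sym (∪-identityʳ B)

-- Eulerian classes and the final count

BO-bijection : ∀ (G : Graph n m) → CutConnected G (λ _ → true) → Bijection (strongClasses G) (BO/Eulerian G)
BO-bijection G conn = bijection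
  (λ (o , strong) → o , strong⇒BO G {o} strong)
  (λ {x} {y} → sameHeads⇒eulerian G {proj₁ x} {proj₁ y})
  (λ {x} {y} → eulerian⇒sameHeads G {proj₁ x} {proj₁ y})
  (λ (o , bo) → (o , BO⇒strong G o conn bo) , sameHeads⇒eulerian G {o} {o} λ S → refl)

theorem1 : ∀ {n m} (G : Graph n m) → Connected G →
    ∃[ α ] HasCardinality (BO/Eulerian G) α
    × (∃[ T ] IsTutte G T)
    × (∀ T → IsTutte G T → α ≡ eval T 0 1)
    × (∀ (_≼_ : Rel (Fin m) 0ℓ) → IsTotalOrder _≡_ _≼_ →
    HasCardinality (treesWithoutInternallyActiveEdge G _≼_) α)
theorem1 {m = m} G connected =
  -- The order on `Fin m` is an arbitrary choice that provides some derivation.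
  let T , isT , _ = tutte-trees G conn _ Fin.≤-isTotalOrder
  in  eval T 0 1 , card-bijection (BO-bijection G conn) (tutte-strongClasses conn isT) , (T , isT) ,
      (λ T′ isT′ → unique isT isT′) ,
      -- Each order leads to its own polynomial `T′`, whose value agrees with that of `T` through
      -- the count of classes.
      λ _≼_ ≼-total → let T′ , isT′ , card = tutte-trees G conn _≼_ ≼-total in
        card-bijection (inactiveTrees-bijection G _≼_)
          (subst (HasCardinality (inactiveTrees G _≼_)) (unique isT′ isT) card)
  where
  conn : CutConnected G (λ _ → true)
  conn = CutConnected-⊤ G connected
  unique : ∀ {T T′} → IsTutte G T → IsTutte G T′ → eval T 0 1 ≡ eval T′ 0 1
  unique isT isT′ = card-unique (tutte-strongClasses conn isT) (tutte-strongClasses conn isT′)
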